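{- For integers $n \ge 1$ and $k \ge 0$, let $u(n,k)$ be the number of symmetric Dyck paths of semi-length $n$ with exactly $k$ valleys, and let $v(n,k) = N_{n,k}(-1)$ be the $q$-Narayana number evaluated at $q=-1$. Then $$u(n,k) = v(n,k) = \binom{\lfloor \frac{n-1}{2} \rfloor}{\lfloor \frac{k}{2} \rfloor}\binom{\lfloor \frac{n}{2} \rfloor}{\lfloor \frac{k+1}{2} \rfloor}.$$
   Context: A Dyck path of semi-length $n$ is a lattice path from $(0,0)$ to $(2n,0)$ consisting of $n$ up steps $U=(1,1)$ and $n$ down steps $D=(1,-1)$ that never goes below the $x$-axis. Writing the path by its heights $(p_0,p_1,\dots,p_{2n}) = (0,p_1,\dots,p_{2n-1},0)$, it is symmetric if $p_i = p_{2n-i}$ for all $0\le i\le n$. A valley is a point where a down step is immediately followed by an up step (a consecutive pair $DU$). For $q$-integers $[m]=[m]_q = \frac{1-q^m}{1-q}$, $[m]! = \prod_{j=1}^m [j]$, and $q$-binomial coefficients $\begin{bmatrix} n \\ k\end{bmatrix} = \frac{[n]!}{[k]![n-k]!}$ for $0\le k\le n$ (and $0$ otherwise), the $q$-Narayana numbers are $N_{n,k}(q) = \frac{1}{[k+1]}\begin{bmatrix} n \\ k\end{bmatrix}\begin{bmatrix} n-1 \\ k\end{bmatrix}$, which are polynomials in $q$; $N_{n,k}(-1)$ denotes evaluation of this polynomial at $q=-1$. Binomial coefficients $\binom{a}{b}$ with $b>a$ are $0$. -}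

module Defs where

open import Data.Bool using (Bool; true; false; _∧_; if_then_else_)
open import Data.Nat as ℕ using (ℕ; zero; suc; _∸_; _≤ᵇ_)
open import Data.Integer as ℤ using (ℤ; +_; -_; _+_; _-_; _*_; _≤ᵇ_; 0ℤ; 1ℤ)
import Data.Integer.Properties as ℤP
open import Data.Bool.ListAction using (and)
open import Data.List using (List; []; _∷_; map; length; reverse; replicate; concatMap; filterᵇ; foldr; _++_)
open import Relation.Nullary.Decidable using (⌊_⌋)

data Step : Set where
  U D : Step

words : ℕ → List (List Step)
words zero = [] ∷ []
words (suc m) = concatMap (λ w → (U ∷ w) ∷ (D ∷ w) ∷ []) (words m)

stepVal : Step → ℤ
stepVal U = + 1
stepVal D = - (+ 1)

heightsFrom : ℤ → List Step → List ℤ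
heightsFrom h [] = []
heightsFrom h (s ∷ w) = (h + stepVal s) ∷ heightsFrom (h + stepVal s) w

heights : List Step → List ℤ
heights w = 0ℤ ∷ heightsFrom 0ℤ w

last0 : List ℤ → Bool
last0 [] = true
last0 (x ∷ []) = ⌊ x ℤ.≟ 0ℤ ⌋
last0 (x ∷ y ∷ xs) = last0 (y ∷ xs)

isDyck : List Step → Bool
isDyck w = and (map (λ h → 0ℤ ℤ.≤ᵇ h) (heights w)) ∧ last0 (heights w)

listEqᵇ : List ℤ → List ℤ → Bool
listEqᵇ [] [] = true
listEqᵇ (x ∷ xs) (y ∷ ys) = ⌊ x ℤ.≟ y ⌋ ∧ listEqᵇ xs ys
listEqᵇ _ _ = false

isSymmetric : List Step → Bool
isSymmetric w = listEqᵇ (heights w) (reverse (heights w))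

valleys : List Step → ℕ
valleys [] = 0
valleys (D ∷ U ∷ w) = suc (valleys (U ∷ w))
valleys (_ ∷ w) = valleys w

u : ℕ → ℕ → ℕ
u n k = length (filterᵇ (λ w → isDyck w ∧ isSymmetric w ∧ ⌊ valleys w ℕ.≟ k ⌋)
                        (words (2 ℕ.* n)))

-- Polynomials over ℤ as coefficient lists, lowest degree first

Poly : Set
Poly = List ℤ

_⊕_ : Poly → Poly → Poly
[] ⊕ q = q
p ⊕ [] = p
(a ∷ p) ⊕ (b ∷ q) = (a + b) ∷ (p ⊕ q)

scale : ℤ → Poly → Poly
scale c = map (c *_)

_⊗_ : Poly → Poly → Poly
[] ⊗ q = []
(a ∷ p) ⊗ q = scale a q ⊕ (0ℤ ∷ (p ⊗ q))

eval : Poly → ℤ → ℤ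
eval p x = foldr (λ c acc → c + x * acc) 0ℤ p

-- Division by a monic polynomial (long division; returns the quotient).
-- Work with coefficient lists highest degree first.
subPad : List ℤ → List ℤ → List ℤ
subPad as [] = as
subPad [] (b ∷ bs) = (- b) ∷ subPad [] bs
subPad (a ∷ as) (b ∷ bs) = (a - b) ∷ subPad as bs

tailL : List ℤ → List ℤ
tailL [] = []
tailL (_ ∷ xs) = xs

divHigh : ℕ → List ℤ → List ℤ → List ℤ
divHigh zero A B = []
divHigh (suc f) [] B = []
divHigh (suc f) (c ∷ A) B = c ∷ divHigh f (subPad A (scale c (tailL B))) B

-- quotient of a by the monic polynomial b (b given with leading coefficient 1
-- as its last entry)
_÷_ : Poly → Poly → Poly
a ÷ b = reverse (divHigh (suc (length a) ∸ length b) (reverse a) (reverse b))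

qInt : ℕ → Poly
qInt m = replicate m 1ℤ

qFact : ℕ → Poly
qFact zero = 1ℤ ∷ []
qFact (suc m) = qFact m ⊗ qInt (suc m)

qBinom : ℕ → ℕ → Poly
qBinom n k = if k ℕ.≤ᵇ n then qFact n ÷ (qFact k ⊗ qFact (n ∸ k)) else []

qNarayana : ℕ → ℕ → Poly
qNarayana n k = (qBinom n k ⊗ qBinom (n ∸ 1) k) ÷ qInt (suc k)

v : ℕ → ℕ → ℤ
v n k = eval (qNarayana n k) (- (+ 1))

{-# OPTIONS --safe #-}
module Submission where

-- Long division of integer polynomials is controlled by values: lists of equal
-- length with equal values at all positive integers coincide.  This identifies
-- the q-binomials with the polynomials of the q-Pascal recursion and gives
--   N(n+1,k) = [n;k]² − q [n;k−1] [n;k+1],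
-- whose value at q = −1 is read off from the recursion.  A symmetric path is
-- mirror q ++ q for its second half q, and it has 2 valleys(q) valleys, plus one at
-- the centre when q starts with U.  Prepending steps to q gives recursions in the
-- length; the only correction counts the halves starting on the axis, which a
-- reflection formula refined by height and valleys evaluates.

open import Defs
open import Data.Bool using (Bool; true; false; _∧_)
open import Data.Empty using (⊥-elim)
open import Data.List using (List; []; _∷_; _++_; length; reverse; replicate; map; concatMap; filterᵇ)
open import Data.List.Properties using (unfold-reverse; length-reverse; length-++; length-map; length-replicate; reverse-involutive; ++-assoc; ++-identityʳ; ∷-injectiveˡ; ∷-injectiveʳ)
open import Data.Nat as ℕ using (ℕ; zero; suc; z≤n; s≤s; ⌊_/2⌋)
import Data.Nat.Properties as ℕP
open import Data.Nat.Combinatorics using (_C_; nCk+nC[k+1]≡[n+1]C[k+1])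
import Data.Nat.Tactic.RingSolver as ℕSolver
open import Data.Integer as ℤ using (ℤ; +_; 0ℤ)
import Data.Integer.Properties as ℤP
import Data.Integer.Tactic.RingSolver as ℤSolver
open import Data.Product using (∃; _×_; _,_; proj₁; proj₂)
open import Algebra.Properties.AbelianGroup ℤP.+-0-abelianGroup using (∙-cancelˡ)
open import Relation.Nullary using (yes; no)
open import Relation.Binary.PropositionalEquality
open ≡-Reasoning

-- The defining quotients cannot be evaluated at q = -1 as they stand: every q-integer of even index
-- vanishes there, and so does every q-factorial from [2]! on. At a positive integer no q-integer of
-- positive index vanishes, so all cancellation takes place at those points; the identities are then
-- carried over to coefficient lists, and only afterwards is -1 inserted. Since `_÷_` works on
-- lists, trailing zeros included, lengths have to be tracked together with values. The determinant
-- suits -1 because its factor -q becomes 1, which leaves a sum of two products of ordinary binomial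
-- coefficients. On the path side, the counts by first step and valleys would form a closed system
-- if `U` could be put in front of every half; this fails for the halves that start on the axis.
-- They exist only in even length, where they are Dyck paths: in length 2m + 2 those with v valleys
-- are counted by the ordinary Narayana number C(m,v)² - C(m,v-1) C(m,v+1). Prepending steps leads
-- away from the axis, so this count has to be proved for all starting heights at once.

pascal : ∀ n k → suc n C suc k ≡ n C k ℕ.+ n C suc k
pascal n k = sym (nCk+nC[k+1]≡[n+1]C[k+1] n k)

-- Parity and halving

double : ℕ → ℕ
double zero = zero
double (suc m) = suc (suc (double m))

data Parity : ℕ → Set where
  even : ∀ m → Parity (double m)
  odd  : ∀ m → Parity (suc (double m))

parity : ∀ n → Parity n
parity zero = even 0
parity (suc n) with parity n
... | even m = odd m
... | odd m = even (suc m)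

⌊double/2⌋ : ∀ m → ⌊ double m /2⌋ ≡ m
⌊double/2⌋ zero = refl
⌊double/2⌋ (suc m) = cong suc (⌊double/2⌋ m)

⌊1+double/2⌋ : ∀ m → ⌊ suc (double m) /2⌋ ≡ m
⌊1+double/2⌋ zero = refl
⌊1+double/2⌋ (suc m) = cong suc (⌊1+double/2⌋ m)

module QNarayana where
  open import Data.Bool.Properties using (T-≡)
  open import Function.Bundles using (Equivalence)
  open import Data.Nat using (_∸_)
  open import Data.Integer using (-_; _+_; _-_; _*_; 1ℤ; -1ℤ; ∣_∣)
  open import Data.Sum using (inj₁; inj₂)
  open ℤSolver using (solve-∀)

  -- Values of polynomial operations

  eval-⊕ : ∀ p q x → eval (p ⊕ q) x ≡ eval p x + eval q x
  eval-⊕ [] q x = sym (ℤP.+-identityˡ _)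
  eval-⊕ (a ∷ p) [] x = sym (ℤP.+-identityʳ _)
  eval-⊕ (a ∷ p) (b ∷ q) x rewrite eval-⊕ p q x = lemma a b x (eval p x) (eval q x)
    where
    lemma : ∀ a b x P Q → a + b + x * (P + Q) ≡ (a + x * P) + (b + x * Q)
    lemma = solve-∀

  eval-scale : ∀ c p x → eval (scale c p) x ≡ c * eval p x
  eval-scale c [] x = sym (ℤP.*-zeroʳ c)
  eval-scale c (a ∷ p) x rewrite eval-scale c p x = lemma c a x (eval p x)
    where
    lemma : ∀ c a x P → c * a + x * (c * P) ≡ c * (a + x * P)
    lemma = solve-∀

  eval-⊗ : ∀ p q x → eval (p ⊗ q) x ≡ eval p x * eval q x
  eval-⊗ [] q x = refl
  eval-⊗ (a ∷ p) q x
    rewrite eval-⊕ (scale a q) (0ℤ ∷ (p ⊗ q)) x | eval-scale a q x | eval-⊗ p q x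
    = lemma a x (eval p x) (eval q x)
    where
    lemma : ∀ a x P Q → a * Q + (0ℤ + x * (P * Q)) ≡ (a + x * P) * Q
    lemma = solve-∀

  eval-++ : ∀ p q x → eval (p ++ q) x ≡ eval p x + x ℤ.^ length p * eval q x
  eval-++ [] q x = lemma (eval q x)
    where
    lemma : ∀ Q → Q ≡ 0ℤ + 1ℤ * Q
    lemma = solve-∀
  eval-++ (a ∷ p) q x rewrite eval-++ p q x = lemma a x (eval p x) (x ℤ.^ length p) (eval q x)
    where
    lemma : ∀ a x P X Q → a + x * (P + X * Q) ≡ (a + x * P) + (x * X) * Q
    lemma = solve-∀

  eval-zeros : ∀ m x → eval (replicate m 0ℤ) x ≡ 0ℤ
  eval-zeros zero x = refl
  eval-zeros (suc m) x rewrite eval-zeros m x = lemma x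
    where
    lemma : ∀ x → 0ℤ + x * 0ℤ ≡ 0ℤ
    lemma = solve-∀

  -- Lengths, and lists determined by their values

  length-⊕-longer : ∀ p q → length p ℕ.≤ length q → length (p ⊕ q) ≡ length q
  length-⊕-longer [] q le = refl
  length-⊕-longer (a ∷ p) (b ∷ q) (s≤s le) = cong suc (length-⊕-longer p q le)

  length-⊕-shorter : ∀ p q → length q ℕ.≤ length p → length (p ⊕ q) ≡ length p
  length-⊕-shorter [] [] le = refl
  length-⊕-shorter (a ∷ p) [] le = refl
  length-⊕-shorter (a ∷ p) (b ∷ q) (s≤s le) = cong suc (length-⊕-shorter p q le)

  length-⊗ : ∀ p q {m l} → length p ≡ suc m → length q ≡ suc l →
             length (p ⊗ q) ≡ suc (m ℕ.+ l)
  length-⊗ (a ∷ []) (b ∷ []) refl refl = refl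
  length-⊗ (a ∷ []) (b ∷ c ∷ q) refl refl = cong (λ t → suc (suc t)) (length-map (a *_) q)
  length-⊗ (a ∷ a′ ∷ p) q {suc m} {l} refl eq with ih ← length-⊗ (a′ ∷ p) q refl eq = begin
    length (scale a q ⊕ (0ℤ ∷ ((a′ ∷ p) ⊗ q)))
      ≡⟨ length-⊕-longer (scale a q) _ (ℕP.≤-trans (ℕP.≤-reflexive (trans (length-map (a *_) q) eq))
           (s≤s (ℕP.≤-trans (ℕP.m≤n+m l (suc m)) (ℕP.≤-reflexive (sym ih))))) ⟩
    suc (length ((a′ ∷ p) ⊗ q))
      ≡⟨ cong suc ih ⟩
    suc (suc m ℕ.+ l) ∎

  -- A multiple a − b of every positive integer vanishes: test it on |a − b| + 1.
  constant-terms-≡ : ∀ a b (P Q : ℤ → ℤ) →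
    (∀ m → a + (+ suc m) * P (+ suc m) ≡ b + (+ suc m) * Q (+ suc m)) → a ≡ b
  constant-terms-≡ a b P Q h = ℤP.i-j≡0⇒i≡j a b (ℤP.∣i∣≡0⇒i≡0 (small ∣ a - b ∣ (∣ Q x - P x ∣) multiple))
    where
    x : ℤ
    x = + suc ∣ a - b ∣
    lemma₁ : ∀ a b x P → a - b ≡ (a + x * P) - (b + x * P)
    lemma₁ = solve-∀
    lemma₂ : ∀ b x P Q → (b + x * Q) - (b + x * P) ≡ x * (Q - P)
    lemma₂ = solve-∀
    multiple : ∣ a - b ∣ ≡ suc ∣ a - b ∣ ℕ.* ∣ Q x - P x ∣
    multiple = trans (cong ∣_∣ (trans (lemma₁ a b x (P x))
                       (trans (cong (_- (b + x * P x)) (h ∣ a - b ∣)) (lemma₂ b x (P x) (Q x)))))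
                     (ℤP.abs-* x (Q x - P x))
    small : ∀ d e → d ≡ suc d ℕ.* e → d ≡ 0
    small d zero eq = trans eq (ℕP.*-zeroʳ (suc d))
    small d (suc e) eq = ⊥-elim (ℕP.1+n≰n (subst (suc d ℕ.≤_) (sym eq) (ℕP.m≤m*n (suc d) (suc e))))

  -- Equal lengths rule out a difference in trailing zeros, which values cannot see. Once the
  -- constant terms agree they cancel, and the remaining factor `+ suc m` is nonzero, so the tails
  -- take the same values.
  eval-injective : ∀ p q → length p ≡ length q →
    (∀ m → eval p (+ suc m) ≡ eval q (+ suc m)) → p ≡ q
  eval-injective [] [] len h = refl
  eval-injective (a ∷ p) (b ∷ q) len h
    with refl ← constant-terms-≡ a b (eval p) (eval q) h
    = cong (a ∷_) (eval-injective p q (ℕP.suc-injective len) λ m →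
        ℤP.*-cancelˡ-≡ (+ suc m) _ _ (∙-cancelˡ a _ _ (h m)))

  -- Monic polynomials and exact long division

  data Monic : Poly → Set where
    one : Monic (1ℤ ∷ [])
    _◂_ : ∀ a {p} → Monic p → Monic (a ∷ p)

  Monic-⊕ : ∀ p {q} → Monic q → length p ℕ.< length q → Monic (p ⊕ q)
  Monic-⊕ [] mq lt = mq
  Monic-⊕ (a ∷ p) one (s≤s ())
  Monic-⊕ (a ∷ p) (b ◂ mq) (s≤s lt) = (a + b) ◂ Monic-⊕ p mq lt

  Monic⇒nonempty : ∀ {p} → Monic p → ∃ λ m → length p ≡ suc m
  Monic⇒nonempty one = 0 , refl
  Monic⇒nonempty (a ◂ mp) = _ , refl

  -- A product with the constant polynomial 1 does not reduce to the other factor; it unfolds to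
  -- this sum, whose last coefficient has to be traced to the end of `q`.
  scale-one-⊕-zero : ∀ {q} → Monic q → Monic (scale 1ℤ q ⊕ (0ℤ ∷ []))
  scale-one-⊕-zero one = one
  scale-one-⊕-zero (a ◂ mq) = _ ◂ drop mq
    where
    drop : ∀ {q} → Monic q → Monic (scale 1ℤ q ⊕ [])
    drop one = one
    drop (a ◂ one) = _ ◂ one
    drop (a ◂ (b ◂ mq)) = _ ◂ drop (b ◂ mq)

  Monic-⊗ : ∀ {p q} → Monic p → Monic q → Monic (p ⊗ q)
  Monic-⊗ one mq = scale-one-⊕-zero mq
  Monic-⊗ {q = q} (_◂_ a {p} mp) mq = Monic-⊕ (scale a q) (0ℤ ◂ Monic-⊗ mp mq) bound
    where
    bound : length (scale a q) ℕ.< suc (length (p ⊗ q))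
    bound with m , pe ← Monic⇒nonempty mp | l , qe ← Monic⇒nonempty mq
      rewrite length-map (a *_) q | length-⊗ p q pe qe | qe = s≤s (s≤s (ℕP.m≤n+m l m))

  reverse-Monic : ∀ {p} → Monic p → ∃ λ B → reverse p ≡ 1ℤ ∷ B
  reverse-Monic one = [] , refl
  reverse-Monic (_◂_ a {p} mp) with B , eq ← reverse-Monic mp =
    B ++ a ∷ [] , trans (unfold-reverse a p) (cong (_++ a ∷ []) eq)

  -- Schoolbook multiplication by 1 ∷ B, coefficients listed from the highest
  -- degree: every step of the long division undoes one step of it.
  mulHigh : List ℤ → List ℤ → List ℤ
  mulHigh [] B = replicate (length B) 0ℤ
  mulHigh (c ∷ q) B = c ∷ mulHigh q B ⊕ scale c B

  length-mulHigh : ∀ q B → length (mulHigh q B) ≡ length q ℕ.+ length B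
  scale-fits : ∀ c q B → length (scale c B) ℕ.≤ length (mulHigh q B)

  length-mulHigh [] B = length-replicate (length B)
  length-mulHigh (c ∷ q) B =
    cong suc (trans (length-⊕-shorter (mulHigh q B) (scale c B) (scale-fits c q B)) (length-mulHigh q B))

  scale-fits c q B rewrite length-map (c *_) B | length-mulHigh q B = ℕP.m≤n+m _ (length q)

  subPad-⊕ : ∀ as bs → length bs ℕ.≤ length as → subPad (as ⊕ bs) bs ≡ as
  subPad-⊕ [] [] le = refl
  subPad-⊕ (a ∷ as) [] le = refl
  subPad-⊕ (a ∷ as) (b ∷ bs) (s≤s le) = cong₂ _∷_ (lemma a b) (subPad-⊕ as bs le)
    where
    lemma : ∀ a b → (a + b) - b ≡ a
    lemma = solve-∀

  divHigh-mulHigh : ∀ q B → divHigh (length q) (mulHigh q B) (1ℤ ∷ B) ≡ q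
  divHigh-mulHigh [] B = refl
  divHigh-mulHigh (c ∷ q) B
    rewrite subPad-⊕ (mulHigh q B) (scale c B) (scale-fits c q B)
    = cong (c ∷_) (divHigh-mulHigh q B)

  evalHigh : List ℤ → ℤ → ℤ
  evalHigh [] x = 0ℤ
  evalHigh (c ∷ p) x = c * x ℤ.^ length p + evalHigh p x

  eval-reverse : ∀ p x → eval (reverse p) x ≡ evalHigh p x
  eval-reverse [] x = refl
  eval-reverse (c ∷ p) x
    rewrite unfold-reverse c p | eval-++ (reverse p) (c ∷ []) x | length-reverse p | eval-reverse p x
    = lemma c x (x ℤ.^ length p) (evalHigh p x)
    where
    lemma : ∀ c x X P → P + X * (c + x * 0ℤ) ≡ c * X + P
    lemma = solve-∀

  evalHigh-zeros : ∀ m x → evalHigh (replicate m 0ℤ) x ≡ 0ℤ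
  evalHigh-zeros zero x = refl
  evalHigh-zeros (suc m) x rewrite evalHigh-zeros m x = refl

  evalHigh-scale : ∀ c p x → evalHigh (scale c p) x ≡ c * evalHigh p x
  evalHigh-scale c [] x = sym (ℤP.*-zeroʳ c)
  evalHigh-scale c (a ∷ p) x rewrite length-map (c *_) p | evalHigh-scale c p x =
    lemma c a (x ℤ.^ length p) (evalHigh p x)
    where
    lemma : ∀ c a X P → c * a * X + c * P ≡ c * (a * X + P)
    lemma = solve-∀

  -- The shorter list is aligned at the leading coefficients.
  evalHigh-⊕ : ∀ as bs d x → length as ≡ d ℕ.+ length bs →
    evalHigh (as ⊕ bs) x ≡ evalHigh as x + x ℤ.^ d * evalHigh bs x
  evalHigh-⊕ [] [] d x len = sym (trans (ℤP.+-identityˡ _) (ℤP.*-zeroʳ (x ℤ.^ d)))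
  evalHigh-⊕ (a ∷ as) [] d x len = lemma (evalHigh (a ∷ as) x) (x ℤ.^ d)
    where
    lemma : ∀ P X → P ≡ P + X * 0ℤ
    lemma = solve-∀
  evalHigh-⊕ [] (b ∷ bs) zero x ()
  evalHigh-⊕ [] (b ∷ bs) (suc d) x ()
  evalHigh-⊕ (a ∷ as) (b ∷ bs) d x len
    with len′ ← ℕP.suc-injective (trans len (ℕP.+-suc d (length bs)))
    rewrite length-⊕-shorter as bs (subst (length bs ℕ.≤_) (sym len′) (ℕP.m≤n+m _ d))
          | evalHigh-⊕ as bs d x len′ | len′ | ℤP.^-distribˡ-+-* x d (length bs)
    = lemma a b (x ℤ.^ d) (x ℤ.^ length bs) (evalHigh as x) (evalHigh bs x)
    where
    lemma : ∀ a b X Y P Q → (a + b) * (X * Y) + (P + X * Q) ≡ a * (X * Y) + P + X * (b * Y + Q)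
    lemma = solve-∀

  evalHigh-mulHigh : ∀ q B x → evalHigh (mulHigh q B) x ≡ evalHigh q x * evalHigh (1ℤ ∷ B) x
  evalHigh-mulHigh [] B x = evalHigh-zeros (length B) x
  evalHigh-mulHigh (c ∷ q) B x
    rewrite length-⊕-shorter (mulHigh q B) (scale c B) (scale-fits c q B)
          | evalHigh-⊕ (mulHigh q B) (scale c B) (length q) x
              (trans (length-mulHigh q B) (cong (length q ℕ.+_) (sym (length-map (c *_) B))))
          | evalHigh-mulHigh q B x | evalHigh-scale c B x | length-mulHigh q B
          | ℤP.^-distribˡ-+-* x (length q) (length B)
    = lemma c (x ℤ.^ length q) (x ℤ.^ length B) (evalHigh q x) (evalHigh B x)
    where
    lemma : ∀ c X Y Q B → c * (X * Y) + (Q * (1ℤ * Y + B) + X * (c * B))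
                          ≡ (c * X + Q) * (1ℤ * Y + B)
    lemma = solve-∀

  -- The length condition says that degrees add. It makes the fuel of the division equal to
  -- `length q`, and it lets the values identify `a` with the schoolbook product of `q` and `b`,
  -- which the division then takes apart.
  ÷-exact : ∀ a q {b} → Monic b → suc (length a) ≡ length q ℕ.+ length b →
    (∀ m → eval a (+ suc m) ≡ eval q (+ suc m) * eval b (+ suc m)) → a ÷ b ≡ q
  ÷-exact a q {b} mb len h with B , eq ← reverse-Monic mb = begin
    reverse (divHigh (suc (length a) ∸ length b) (reverse a) (reverse b))
      ≡⟨ cong (λ f → reverse (divHigh f (reverse a) (reverse b))) fuel ⟩
    reverse (divHigh (length (reverse q)) (reverse a) (reverse b))
      ≡⟨ cong₂ (λ A B → reverse (divHigh (length (reverse q)) A B)) product eq ⟩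
    reverse (divHigh (length (reverse q)) (mulHigh (reverse q) B) (1ℤ ∷ B))
      ≡⟨ cong reverse (divHigh-mulHigh (reverse q) B) ⟩
    reverse (reverse q)
      ≡⟨ reverse-involutive q ⟩
    q ∎
    where
    fuel : suc (length a) ∸ length b ≡ length (reverse q)
    fuel = trans (cong (_∸ length b) len)
             (trans (ℕP.m+n∸n≡m (length q) (length b)) (sym (length-reverse q)))
    length-b : length b ≡ suc (length B)
    length-b = trans (sym (length-reverse b)) (cong length eq)
    lengths : length a ≡ length (reverse (mulHigh (reverse q) B))
    lengths rewrite length-reverse (mulHigh (reverse q) B) | length-mulHigh (reverse q) B | length-reverse q
      = ℕP.suc-injective (trans len (trans (cong (length q ℕ.+_) length-b) (ℕP.+-suc (length q) (length B))))
    evals : ∀ m → eval a (+ suc m) ≡ eval (reverse (mulHigh (reverse q) B)) (+ suc m)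
    evals m = begin
      eval a x                                       ≡⟨ h m ⟩
      eval q x * eval b x                            ≡⟨ cong₂ (λ q b → eval q x * eval b x) (sym (reverse-involutive q)) (sym (reverse-involutive b)) ⟩
      eval (reverse (reverse q)) x * eval (reverse (reverse b)) x
                                                     ≡⟨ cong₂ _*_ (eval-reverse (reverse q) x) (trans (eval-reverse (reverse b) x) (cong (λ L → evalHigh L x) eq)) ⟩
      evalHigh (reverse q) x * evalHigh (1ℤ ∷ B) x   ≡⟨ evalHigh-mulHigh (reverse q) B x ⟨
      evalHigh (mulHigh (reverse q) B) x             ≡⟨ eval-reverse (mulHigh (reverse q) B) x ⟨
      eval (reverse (mulHigh (reverse q) B)) x       ∎
      where
      x : ℤ
      x = + suc m
    product : reverse a ≡ mulHigh (reverse q) B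
    product = trans (cong reverse (eval-injective a (reverse (mulHigh (reverse q) B)) lengths evals)) (reverse-involutive (mulHigh (reverse q) B))

  -- q-binomials from the q-Pascal recursion

  ⊕-identityʳ : ∀ p → p ⊕ [] ≡ p
  ⊕-identityʳ [] = refl
  ⊕-identityʳ (a ∷ p) = refl

  -- The zero polynomial is kept as [], so that lengths record degrees.
  shift : ℕ → Poly → Poly
  shift m [] = []
  shift m p@(_ ∷ _) = replicate m 0ℤ ++ p

  eval-shift : ∀ m p x → eval (shift m p) x ≡ x ℤ.^ m * eval p x
  eval-shift m [] x = sym (ℤP.*-zeroʳ (x ℤ.^ m))
  eval-shift m p@(_ ∷ _) x rewrite eval-++ (replicate m 0ℤ) p x | eval-zeros m x | length-replicate m {0ℤ}
    = ℤP.+-identityˡ _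

  length-shift : ∀ m p {l} → length p ≡ suc l → length (shift m p) ≡ m ℕ.+ suc l
  length-shift m p@(_ ∷ _) refl rewrite length-++ (replicate m 0ℤ) {p} | length-replicate m {0ℤ} = refl

  -- In this form of the q-Pascal rule the power of q depends on k alone, so at q = -1 its sign is
  -- decided by the parity of k.
  gauss : ℕ → ℕ → Poly
  gauss n zero = 1ℤ ∷ []
  gauss zero (suc k) = []
  gauss (suc n) (suc k) = gauss n k ⊕ shift (suc k) (gauss n (suc k))

  gauss-vanishes : ∀ n d → gauss n (suc (n ℕ.+ d)) ≡ []
  gauss-vanishes zero d = refl
  gauss-vanishes (suc n) d rewrite gauss-vanishes n d | sym (ℕP.+-suc n d) | gauss-vanishes n (suc d) = refl

  gauss-vanishes-next : ∀ n → gauss n (suc n) ≡ []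
  gauss-vanishes-next n = subst (λ t → gauss n (suc t) ≡ []) (ℕP.+-identityʳ n) (gauss-vanishes n 0)

  -- The degree is k l. In the recursion the shifted summand has degree (k+1)(l+1), which exceeds
  -- that of the other summand by l + 1, so it alone fixes the length.
  length-gauss : ∀ k l → length (gauss (k ℕ.+ l) k) ≡ suc (k ℕ.* l)
  length-gauss zero l = refl
  length-gauss (suc k) zero
    rewrite ℕP.+-identityʳ k | gauss-vanishes-next k | ⊕-identityʳ (gauss k k)
    = subst (λ t → length (gauss t k) ≡ suc (k ℕ.* 0)) (ℕP.+-identityʳ k) (length-gauss k zero)
  length-gauss (suc k) (suc l)
    with ih₁ ← length-gauss k (suc l) | ih₂ ← length-gauss (suc k) l = begin
    length (gauss n k ⊕ q)       ≡⟨ length-⊕-longer (gauss n k) q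
                                      (subst₂ ℕ._≤_ (sym ih₁) (sym length-q) bound) ⟩
    length q                     ≡⟨ length-q ⟩
    suc k ℕ.+ suc (suc k ℕ.* l)  ≡⟨ arith k l ⟩
    suc (suc k ℕ.* suc l)        ∎
    where
    n : ℕ
    n = k ℕ.+ suc l
    q : Poly
    q = shift (suc k) (gauss n (suc k))
    length-q : length q ≡ suc k ℕ.+ suc (suc k ℕ.* l)
    length-q = length-shift (suc k) (gauss n (suc k))
      (subst (λ t → length (gauss t (suc k)) ≡ suc (suc k ℕ.* l)) (sym (ℕP.+-suc k l)) ih₂)
    arith : ∀ k l → suc k ℕ.+ suc (suc k ℕ.* l) ≡ suc (suc k ℕ.* suc l)
    arith = ℕSolver.solve-∀
    arith′ : ∀ k l → suc k ℕ.+ suc (suc k ℕ.* l) ≡ suc (k ℕ.* suc l) ℕ.+ suc l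
    arith′ = ℕSolver.solve-∀
    bound : suc (k ℕ.* suc l) ℕ.≤ suc k ℕ.+ suc (suc k ℕ.* l)
    bound = subst (suc (k ℕ.* suc l) ℕ.≤_) (sym (arith′ k l)) (ℕP.m≤m+n _ (suc l))

  eval-gauss-suc : ∀ n k x → eval (gauss (suc n) (suc k)) x
                           ≡ eval (gauss n k) x + x ℤ.^ suc k * eval (gauss n (suc k)) x
  eval-gauss-suc n k x
    rewrite eval-⊕ (gauss n k) (shift (suc k) (gauss n (suc k))) x
          | eval-shift (suc k) (gauss n (suc k)) x = refl

  [_]at_ : ℕ → ℤ → ℤ
  [ m ]at x = eval (qInt m) x

  _!at_ : ℕ → ℤ → ℤ
  m !at x = eval (qFact m) x

  qInt-+ : ∀ k l x → [ k ℕ.+ l ]at x ≡ [ k ]at x + x ℤ.^ k * [ l ]at x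
  qInt-+ zero l x = lemma ([ l ]at x)
    where
    lemma : ∀ L → L ≡ 0ℤ + 1ℤ * L
    lemma = solve-∀
  qInt-+ (suc k) l x rewrite qInt-+ k l x = lemma x (x ℤ.^ k) ([ k ]at x) ([ l ]at x)
    where
    lemma : ∀ x X K L → 1ℤ + x * (K + X * L) ≡ 1ℤ + x * K + x * X * L
    lemma = solve-∀

  !at-suc : ∀ m x → suc m !at x ≡ (m !at x) * [ suc m ]at x
  !at-suc m x = eval-⊗ (qFact m) (qInt (suc m)) x

  -- For (k+1, l+1) and n = k + l + 1, multiplication by the factorials turns the two summands of
  -- the q-Pascal rule into [n]! [k+1] and [n]! q^(k+1) [l+1], and these add up to [n]! [n+1].
  gauss-! : ∀ k l x → eval (gauss (k ℕ.+ l) k) x * ((k !at x) * (l !at x)) ≡ (k ℕ.+ l) !at x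
  gauss-! zero l x = lemma x (l !at x)
    where
    lemma : ∀ x L → (1ℤ + x * 0ℤ) * ((1ℤ + x * 0ℤ) * L) ≡ L
    lemma = solve-∀
  gauss-! (suc k) zero x = begin
    eval (gauss (suc k ℕ.+ 0) (suc k)) x * (F * (1ℤ + x * 0ℤ))
      ≡⟨ cong (_* (F * (1ℤ + x * 0ℤ))) (trans (cong (λ t → eval (gauss t (suc k)) x) (ℕP.+-identityʳ (suc k))) (diagonal (suc k))) ⟩
    1ℤ * (F * (1ℤ + x * 0ℤ))
      ≡⟨ lemma x F ⟩
    F ≡⟨ cong (_!at x) (sym (ℕP.+-identityʳ (suc k))) ⟩
    (suc k ℕ.+ 0) !at x ∎
    where
    F : ℤ
    F = suc k !at x
    lemma : ∀ x F → 1ℤ * (F * (1ℤ + x * 0ℤ)) ≡ F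
    lemma = solve-∀
    lemma′ : ∀ x → 1ℤ + x * 0ℤ ≡ 1ℤ
    lemma′ = solve-∀
    diagonal : ∀ m → eval (gauss m m) x ≡ 1ℤ
    diagonal zero = lemma′ x
    diagonal (suc m) rewrite gauss-vanishes-next m | ⊕-identityʳ (gauss m m) = diagonal m
  gauss-! (suc k) (suc l) x = begin
    eval (gauss (suc n) (suc k)) x * (F k+1 * F l+1)
      ≡⟨ cong₂ _*_ (eval-gauss-suc n k x) (cong₂ _*_ (!at-suc k x) (!at-suc l x)) ⟩
    (P + X * Q) * ((F k * I k+1) * (F l * I l+1))
      ≡⟨ lemma₁ P Q X (F k) (F l) (I k+1) (I l+1) ⟩
    (P * (F k * (F l * I l+1))) * I k+1 + (Q * ((F k * I k+1) * F l)) * (X * I l+1)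
      ≡⟨ cong₂ (λ a b → a * I k+1 + b * (X * I l+1)) left right ⟩
    F n * I k+1 + F n * (X * I l+1)
      ≡⟨ lemma₂ (F n) (I k+1) (X * I l+1) ⟩
    F n * (I k+1 + X * I l+1)
      ≡⟨ cong (F n *_) (qInt-+ k+1 l+1 x) ⟨
    F n * I (suc n)
      ≡⟨ !at-suc n x ⟨
    F (suc n) ∎
    where
    n k+1 l+1 : ℕ
    n = k ℕ.+ suc l
    k+1 = suc k
    l+1 = suc l
    F I : ℕ → ℤ
    F m = m !at x
    I m = [ m ]at x
    P Q X : ℤ
    P = eval (gauss n k) x
    Q = eval (gauss n (suc k)) x
    X = x ℤ.^ suc k
    left : P * (F k * (F l * I l+1)) ≡ F n
    left = trans (cong (λ t → P * (F k * t)) (sym (!at-suc l x))) (gauss-! k (suc l) x)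
    right : Q * ((F k * I k+1) * F l) ≡ F n
    right = trans (cong (λ t → Q * (t * F l)) (sym (!at-suc k x)))
      (subst (λ t → eval (gauss t (suc k)) x * (F k+1 * F l) ≡ F t) (sym (ℕP.+-suc k l)) (gauss-! (suc k) l x))
    lemma₁ : ∀ P Q X a b c d → (P + X * Q) * ((a * c) * (b * d)) ≡ (P * (a * (b * d))) * c + (Q * ((a * c) * b)) * (X * d)
    lemma₁ = solve-∀
    lemma₂ : ∀ a b c → a * b + a * c ≡ a * (b + c)
    lemma₂ = solve-∀

  -- Cancellation at positive integers, and q-binomials as quotients

  Positive : ℤ → Set
  Positive i = ∃ λ t → i ≡ + suc t

  Positive-* : ∀ {i j} → Positive i → Positive j → Positive (i * j)
  Positive-* (s , refl) (t , refl) = _ , refl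

  *-cancelʳ-Positive : ∀ {i j c} → Positive c → i * c ≡ j * c → i ≡ j
  *-cancelʳ-Positive {i} {j} (t , refl) eq = ℤP.*-cancelʳ-≡ i j (+ suc t) eq

  qInt-Positive : ∀ m k → Positive ([ suc k ]at (+ suc m))
  qInt-Positive m zero rewrite ℤP.*-zeroʳ (+ suc m) = _ , refl
  qInt-Positive m (suc k) with t , eq ← qInt-Positive m k rewrite eq = _ , refl

  !at-Positive : ∀ m k → Positive (k !at (+ suc m))
  !at-Positive m zero rewrite ℤP.*-zeroʳ (+ suc m) = _ , refl
  !at-Positive m (suc k) = subst Positive (sym (!at-suc k (+ suc m)))
    (Positive-* (!at-Positive m k) (qInt-Positive m k))

  Monic-qInt : ∀ m → Monic (qInt (suc m))
  Monic-qInt zero = one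
  Monic-qInt (suc m) = 1ℤ ◂ Monic-qInt m

  Monic-qFact : ∀ m → Monic (qFact m)
  Monic-qFact zero = one
  Monic-qFact (suc m) = Monic-⊗ (Monic-qFact m) (Monic-qInt m)

  -- The sum 0 + 1 + ... + (m - 1), which is the degree of [m]!.
  triangle : ℕ → ℕ
  triangle zero = 0
  triangle (suc m) = triangle m ℕ.+ m

  triangle-+ : ∀ k l → triangle (k ℕ.+ l) ≡ k ℕ.* l ℕ.+ (triangle k ℕ.+ triangle l)
  triangle-+ zero l = refl
  triangle-+ (suc k) l rewrite triangle-+ k l = lemma k l (triangle k) (triangle l)
    where
    lemma : ∀ k l s t → k ℕ.* l ℕ.+ (s ℕ.+ t) ℕ.+ (k ℕ.+ l) ≡ suc k ℕ.* l ℕ.+ (s ℕ.+ k ℕ.+ t)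
    lemma = ℕSolver.solve-∀

  length-qFact : ∀ m → length (qFact m) ≡ suc (triangle m)
  length-qFact zero = refl
  length-qFact (suc m) = length-⊗ (qFact m) (qInt (suc m)) (length-qFact m) (cong suc (length-replicate m))

  qBinom-≤ : ∀ k l → qBinom (k ℕ.+ l) k ≡ qFact (k ℕ.+ l) ÷ (qFact k ⊗ qFact l)
  qBinom-≤ k l
    rewrite Equivalence.to T-≡ (ℕP.≤⇒≤ᵇ (ℕP.m≤m+n k l)) | ℕP.m+n∸m≡n k l = refl

  qBinom≡gauss : ∀ k l → qBinom (k ℕ.+ l) k ≡ gauss (k ℕ.+ l) k
  qBinom≡gauss k l = trans (qBinom-≤ k l)
    (÷-exact (qFact (k ℕ.+ l)) (gauss (k ℕ.+ l) k) (Monic-⊗ (Monic-qFact k) (Monic-qFact l)) lengths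
      λ m → sym (trans (cong (eval (gauss (k ℕ.+ l) k) (+ suc m) *_) (eval-⊗ (qFact k) (qFact l) (+ suc m)))
                       (gauss-! k l (+ suc m))))
    where
    lengths : suc (length (qFact (k ℕ.+ l))) ≡ length (gauss (k ℕ.+ l) k) ℕ.+ length (qFact k ⊗ qFact l)
    lengths rewrite length-qFact (k ℕ.+ l) | length-gauss k l
                  | length-⊗ (qFact k) (qFact l) (length-qFact k) (length-qFact l) | triangle-+ k l
      = cong suc (sym (ℕP.+-suc (k ℕ.* l) _))

  -- The q-Narayana quotient as a determinant

  qInt-*-qInt : ∀ k l x → [ suc k ]at x * [ suc l ]at x ≡ x * ([ k ]at x * [ l ]at x) + [ suc (k ℕ.+ l) ]at x
  qInt-*-qInt zero l x = lemma x ([ l ]at x)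
    where
    lemma : ∀ x L → (1ℤ + x * 0ℤ) * (1ℤ + x * L) ≡ x * (0ℤ * L) + (1ℤ + x * L)
    lemma = solve-∀
  qInt-*-qInt (suc k) l x = begin
    (1ℤ + x * [ suc k ]at x) * [ suc l ]at x
      ≡⟨ lemma₁ x ([ suc k ]at x) ([ suc l ]at x) ⟩
    [ suc l ]at x + x * ([ suc k ]at x * [ suc l ]at x)
      ≡⟨ cong (λ t → [ suc l ]at x + x * t) (qInt-*-qInt k l x) ⟩
    (1ℤ + x * [ l ]at x) + x * (x * ([ k ]at x * [ l ]at x) + [ suc (k ℕ.+ l) ]at x)
      ≡⟨ lemma₂ x ([ k ]at x) ([ l ]at x) ([ suc (k ℕ.+ l) ]at x) ⟩
    x * ((1ℤ + x * [ k ]at x) * [ l ]at x) + (1ℤ + x * [ suc (k ℕ.+ l) ]at x) ∎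
    where
    lemma₁ : ∀ x K L → (1ℤ + x * K) * L ≡ L + x * (K * L)
    lemma₁ = solve-∀
    lemma₂ : ∀ x K L M → (1ℤ + x * L) + x * (x * (K * L) + M) ≡ x * ((1ℤ + x * K) * L) + (1ℤ + x * M)
    lemma₂ = solve-∀

  module _ (m : ℕ) where
    private
      x : ℤ
      x = + suc m
      F I : ℕ → ℤ
      F k = k !at x
      I k = [ k ]at x
      g : ℕ → ℕ → ℤ
      g n k = eval (gauss n k) x

    -- The ratio of neighbours in a row, cleared of denominators: for l > 0 both sides become [k+l]!
    -- after multiplication by [k]! [l-1]!.
    gauss-suc-right : ∀ k l → g (k ℕ.+ l) (suc k) * I (suc k) ≡ g (k ℕ.+ l) k * I l
    gauss-suc-right k zero rewrite ℕP.+-identityʳ k | gauss-vanishes-next k = sym (ℤP.*-zeroʳ (g k k))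
    gauss-suc-right k (suc l) = *-cancelʳ-Positive (Positive-* (!at-Positive m k) (!at-Positive m l)) (begin
      (G₁ * I (suc k)) * (F k * F l)      ≡⟨ lemma₁ G₁ (I (suc k)) (F k) (F l) ⟩
      G₁ * ((F k * I (suc k)) * F l)      ≡⟨ cong (λ t → G₁ * (t * F l)) (sym (!at-suc k x)) ⟩
      G₁ * (F (suc k) * F l)              ≡⟨ subst (λ t → g t (suc k) * (F (suc k) * F l) ≡ F t)
                                               (sym (ℕP.+-suc k l)) (gauss-! (suc k) l x) ⟩
      F (k ℕ.+ suc l)                     ≡⟨ gauss-! k (suc l) x ⟨
      G₀ * (F k * F (suc l))              ≡⟨ cong (λ t → G₀ * (F k * t)) (!at-suc l x) ⟩
      G₀ * (F k * (F l * I (suc l)))      ≡⟨ lemma₂ G₀ (I (suc l)) (F k) (F l) ⟩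
      (G₀ * I (suc l)) * (F k * F l)      ∎)
      where
      G₀ G₁ : ℤ
      G₀ = g (k ℕ.+ suc l) k
      G₁ = g (k ℕ.+ suc l) (suc k)
      lemma₁ : ∀ G I K L → (G * I) * (K * L) ≡ G * ((K * I) * L)
      lemma₁ = solve-∀
      lemma₂ : ∀ G I K L → G * (K * (L * I)) ≡ (G * I) * (K * L)
      lemma₂ = solve-∀

    gauss-suc-left : ∀ k l → g (k ℕ.+ suc l) k * I (suc l) ≡ g (k ℕ.+ l) k * I (suc (k ℕ.+ l))
    gauss-suc-left k l = *-cancelʳ-Positive (Positive-* (!at-Positive m k) (!at-Positive m l)) (begin
      (G₁ * I (suc l)) * (F k * F l)           ≡⟨ lemma₁ G₁ (I (suc l)) (F k) (F l) ⟩
      G₁ * (F k * (F l * I (suc l)))           ≡⟨ cong (λ t → G₁ * (F k * t)) (sym (!at-suc l x)) ⟩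
      G₁ * (F k * F (suc l))                   ≡⟨ gauss-! k (suc l) x ⟩
      F (k ℕ.+ suc l)                          ≡⟨ trans (cong F (ℕP.+-suc k l)) (!at-suc (k ℕ.+ l) x) ⟩
      F (k ℕ.+ l) * I (suc (k ℕ.+ l))          ≡⟨ cong (_* I (suc (k ℕ.+ l))) (sym (gauss-! k l x)) ⟩
      G₀ * (F k * F l) * I (suc (k ℕ.+ l))     ≡⟨ lemma₂ G₀ (I (suc (k ℕ.+ l))) (F k) (F l) ⟩
      (G₀ * I (suc (k ℕ.+ l))) * (F k * F l)   ∎)
      where
      G₀ G₁ : ℤ
      G₀ = g (k ℕ.+ l) k
      G₁ = g (k ℕ.+ suc l) k
      lemma₁ : ∀ G I K L → (G * I) * (K * L) ≡ G * (K * (L * I))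
      lemma₁ = solve-∀
      lemma₂ : ∀ G I K L → G * (K * L) * I ≡ (G * I) * (K * L)
      lemma₂ = solve-∀

  -- N(n+1,k) as a 2 × 2 determinant of q-binomials, so that no division occurs.
  narayana : ℕ → ℕ → Poly
  narayana n zero = 1ℤ ∷ []
  narayana n (suc k) = (gauss n (suc k) ⊗ gauss n (suc k))
                     ⊕ scale (- 1ℤ) (0ℤ ∷ (gauss n (suc (suc k)) ⊗ gauss n k))

  eval-narayana : ∀ n k x → eval (narayana n (suc k)) x
    ≡ eval (gauss n (suc k)) x * eval (gauss n (suc k)) x
      - x * (eval (gauss n (suc (suc k))) x * eval (gauss n k) x)
  eval-narayana n k x
    rewrite eval-⊕ (gauss n (suc k) ⊗ gauss n (suc k)) (scale (- 1ℤ) (0ℤ ∷ (gauss n (suc (suc k)) ⊗ gauss n k))) x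
          | eval-scale (- 1ℤ) (0ℤ ∷ (gauss n (suc (suc k)) ⊗ gauss n k)) x
          | eval-⊗ (gauss n (suc k)) (gauss n (suc k)) x
          | eval-⊗ (gauss n (suc (suc k))) (gauss n k) x
    = lemma (eval (gauss n (suc k)) x) (eval (gauss n (suc (suc k))) x) (eval (gauss n k) x) x
    where
    lemma : ∀ P Q R x → P * P + - 1ℤ * (0ℤ + x * (Q * R)) ≡ P * P - x * (Q * R)
    lemma = solve-∀

  -- The square determines the degree: the term subtracted from it, with its factor q, is shorter by
  -- one, or comes from an empty q-binomial when l = 0. Hence the leading coefficient is never
  -- touched.
  length-narayana : ∀ k l → length (narayana (k ℕ.+ l) k) ≡ suc (k ℕ.* l ℕ.+ k ℕ.* l)
  length-narayana zero l = refl
  length-narayana (suc k) l = trans (length-⊕-shorter (P ⊗ P) (scale (- 1ℤ) (0ℤ ∷ R)) bound) len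
    where
    P R : Poly
    P = gauss (suc k ℕ.+ l) (suc k)
    R = gauss (suc k ℕ.+ l) (suc (suc k)) ⊗ gauss (suc k ℕ.+ l) k
    len : length (P ⊗ P) ≡ suc (suc k ℕ.* l ℕ.+ suc k ℕ.* l)
    len = length-⊗ P P (length-gauss (suc k) l) (length-gauss (suc k) l)
    second : ∀ l → length (gauss (suc k ℕ.+ l) (suc (suc k)) ⊗ gauss (suc k ℕ.+ l) k)
                 ℕ.≤ suc k ℕ.* l ℕ.+ suc k ℕ.* l
    second zero rewrite ℕP.+-identityʳ k | gauss-vanishes-next (suc k) = z≤n
    second (suc l) = ℕP.<⇒≤ (ℕP.≤-reflexive (trans (cong suc
      (length-⊗ (gauss (suc k ℕ.+ suc l) (suc (suc k))) (gauss (suc k ℕ.+ suc l) k)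
        (subst (λ t → length (gauss t (suc (suc k))) ≡ suc (suc (suc k) ℕ.* l)) (sym (ℕP.+-suc (suc k) l))
          (length-gauss (suc (suc k)) l))
        (subst (λ t → length (gauss t k) ≡ suc (k ℕ.* suc (suc l))) (ℕP.+-suc k (suc l))
          (length-gauss k (suc (suc l))))))
      (arith k l)))
      where
      arith : ∀ k l → suc (suc (suc (suc k) ℕ.* l ℕ.+ k ℕ.* suc (suc l))) ≡ suc k ℕ.* suc l ℕ.+ suc k ℕ.* suc l
      arith = ℕSolver.solve-∀
    bound : length (scale (- 1ℤ) (0ℤ ∷ R)) ℕ.≤ length (P ⊗ P)
    bound rewrite length-map (- 1ℤ *_) R | len = s≤s (second l)

  -- Let A = [k+l;k]. Multiplication by [l+1] turns the left-hand side into A² [k+l+1], and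
  -- `qInt-*-qInt` replaces [k+l+1] by [k+1][l+1] - q [k][l]. The factors A [l] and A [k] of the
  -- second term are then converted into the right and left neighbours of A in its row.
  narayana-qInt : ∀ k l m → let x = + suc m in
    eval (gauss (k ℕ.+ suc l) k) x * eval (gauss (k ℕ.+ l) k) x
      ≡ eval (narayana (k ℕ.+ l) k) x * [ suc k ]at x
  narayana-qInt zero l m = refl
  narayana-qInt (suc k) l m = *-cancelʳ-Positive (qInt-Positive m l) (begin
    (G * A) * L₁
      ≡⟨ lemma₁ G A L₁ ⟩
    (G * L₁) * A
      ≡⟨ cong (_* A) (gauss-suc-left m (suc k) l) ⟩
    (A * M) * A
      ≡⟨ lemma₂ A M K L x ⟩
    A * A * (x * (K * L) + M) - x * ((A * L) * (A * K))
      ≡⟨ cong₂ (λ s t → A * A * s - x * t) (sym (qInt-*-qInt (suc k) l x))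
           (cong₂ _*_ (sym (gauss-suc-right m (suc k) l)) below) ⟩
    A * A * (K₁ * L₁) - x * ((A₊ * K₁) * (A₋ * L₁))
      ≡⟨ lemma₃ A A₊ A₋ K₁ L₁ x ⟩
    (A * A - x * (A₊ * A₋)) * K₁ * L₁
      ≡⟨ cong (λ t → t * K₁ * L₁) (eval-narayana (suc k ℕ.+ l) k x) ⟨
    eval (narayana (suc k ℕ.+ l) (suc k)) x * K₁ * L₁ ∎)
    where
    x K L K₁ L₁ M G A A₊ A₋ : ℤ
    x = + suc m
    K = [ suc k ]at x
    L = [ l ]at x
    K₁ = [ suc (suc k) ]at x
    L₁ = [ suc l ]at x
    M = [ suc (suc k ℕ.+ l) ]at x
    G = eval (gauss (suc k ℕ.+ suc l) (suc k)) x
    A = eval (gauss (suc k ℕ.+ l) (suc k)) x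
    A₊ = eval (gauss (suc k ℕ.+ l) (suc (suc k))) x
    A₋ = eval (gauss (suc k ℕ.+ l) k) x
    below : A * K ≡ A₋ * L₁
    below = subst (λ t → eval (gauss t (suc k)) x * K ≡ eval (gauss t k) x * L₁) (ℕP.+-suc k l)
              (gauss-suc-right m k (suc l))
    lemma₁ : ∀ G A L → (G * A) * L ≡ (G * L) * A
    lemma₁ = solve-∀
    lemma₂ : ∀ A M K L x → (A * M) * A ≡ A * A * (x * (K * L) + M) - x * ((A * L) * (A * K))
    lemma₂ = solve-∀
    lemma₃ : ∀ A A₊ A₋ K L x → A * A * (K * L) - x * ((A₊ * K) * (A₋ * L)) ≡ (A * A - x * (A₊ * A₋)) * K * L
    lemma₃ = solve-∀

  qNarayana≡narayana : ∀ k l → qNarayana (suc (k ℕ.+ l)) k ≡ narayana (k ℕ.+ l) k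
  qNarayana≡narayana k l = trans
    (cong₂ (λ s t → (s ⊗ t) ÷ qInt (suc k))
      (subst (λ t → qBinom t k ≡ gauss t k) (ℕP.+-suc k l) (qBinom≡gauss k (suc l)))
      (qBinom≡gauss k l))
    (÷-exact (G ⊗ A) (narayana (k ℕ.+ l) k) (Monic-qInt k) lengths evals)
    where
    G A : Poly
    G = gauss (suc (k ℕ.+ l)) k
    A = gauss (k ℕ.+ l) k
    length-G : length G ≡ suc (k ℕ.* suc l)
    length-G = subst (λ t → length (gauss t k) ≡ suc (k ℕ.* suc l)) (ℕP.+-suc k l) (length-gauss k (suc l))
    arith : ∀ k l → suc (suc (k ℕ.* suc l ℕ.+ k ℕ.* l)) ≡ suc (k ℕ.* l ℕ.+ k ℕ.* l) ℕ.+ suc k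
    arith = ℕSolver.solve-∀
    lengths : suc (length (G ⊗ A)) ≡ length (narayana (k ℕ.+ l) k) ℕ.+ length (qInt (suc k))
    lengths rewrite length-⊗ G A length-G (length-gauss k l) | length-narayana k l | length-replicate k {1ℤ}
      = arith k l
    evals : ∀ m → eval (G ⊗ A) (+ suc m) ≡ eval (narayana (k ℕ.+ l) k) (+ suc m) * [ suc k ]at (+ suc m)
    evals m = trans (eval-⊗ G A (+ suc m))
      (trans (cong (λ t → eval (gauss t k) (+ suc m) * eval A (+ suc m)) (sym (ℕP.+-suc k l)))
        (narayana-qInt k l m))

  -- Values at q = -1

  -1^double : ∀ i → -1ℤ ℤ.^ double i ≡ 1ℤ
  -1^double zero = refl
  -1^double (suc i) rewrite -1^double i = refl

  gauss₋₁ : ℕ → ℕ → ℤ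
  gauss₋₁ n k = eval (gauss n k) -1ℤ

  gauss₋₁-suc-odd : ∀ n i → gauss₋₁ (suc n) (suc (double i)) ≡ gauss₋₁ n (double i) - gauss₋₁ n (suc (double i))
  gauss₋₁-suc-odd n i rewrite eval-gauss-suc n (double i) -1ℤ | -1^double i =
    lemma (gauss₋₁ n (double i)) (gauss₋₁ n (suc (double i)))
    where
    lemma : ∀ P Q → P + - 1ℤ * Q ≡ P - Q
    lemma = solve-∀

  gauss₋₁-suc-even : ∀ n i → gauss₋₁ (suc n) (double (suc i)) ≡ gauss₋₁ n (suc (double i)) + gauss₋₁ n (double (suc i))
  gauss₋₁-suc-even n i rewrite eval-gauss-suc n (suc (double i)) -1ℤ | -1^double i =
    cong (λ t → gauss₋₁ n (suc (double i)) + t) (ℤP.*-identityˡ _)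

  -- Two steps of the q-Pascal rule at -1 amount to one step of Pascal's rule in m, while the
  -- entries of odd index in an even row cancel. This is the case q = -1 of the q-Lucas theorem.
  gauss₋₁-even-even : ∀ m i → gauss₋₁ (double m) (double i) ≡ + (m C i)
  gauss₋₁-even-odd : ∀ m i → gauss₋₁ (double m) (suc (double i)) ≡ 0ℤ
  gauss₋₁-odd-even : ∀ m i → gauss₋₁ (suc (double m)) (double i) ≡ + (m C i)
  gauss₋₁-odd-odd : ∀ m i → gauss₋₁ (suc (double m)) (suc (double i)) ≡ + (m C i)

  gauss₋₁-even-even m zero = refl
  gauss₋₁-even-even zero (suc i) = refl
  gauss₋₁-even-even (suc m) (suc i)
    rewrite gauss₋₁-suc-even (suc (double m)) i | gauss₋₁-odd-odd m i | gauss₋₁-odd-even m (suc i)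
          | pascal m i = refl

  gauss₋₁-even-odd zero i = refl
  gauss₋₁-even-odd (suc m) i
    rewrite gauss₋₁-suc-odd (suc (double m)) i | gauss₋₁-odd-odd m i | gauss₋₁-odd-even m i
    = ℤP.+-inverseʳ (+ (m C i))

  gauss₋₁-odd-even m zero = refl
  gauss₋₁-odd-even m (suc i)
    rewrite gauss₋₁-suc-even (double m) i | gauss₋₁-even-odd m i | gauss₋₁-even-even m (suc i) = refl

  gauss₋₁-odd-odd m i
    rewrite gauss₋₁-suc-odd (double m) i | gauss₋₁-even-even m i | gauss₋₁-even-odd m i
    = ℤP.+-identityʳ (+ (m C i))

  narayana₋₁ : ℕ → ℕ → ℤ
  narayana₋₁ n k = eval (narayana n k) -1ℤ

  -- The sign of the determinant disappears since -q = 1. In an even row one of the two products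
  -- always vanishes; in an odd row they combine by Pascal's rule.
  narayana₋₁-suc : ∀ n k → narayana₋₁ n (suc k)
    ≡ gauss₋₁ n (suc k) * gauss₋₁ n (suc k) + gauss₋₁ n (suc (suc k)) * gauss₋₁ n k
  narayana₋₁-suc n k rewrite eval-narayana n k -1ℤ =
    lemma (gauss₋₁ n (suc k)) (gauss₋₁ n (suc (suc k))) (gauss₋₁ n k)
    where
    lemma : ∀ P Q R → P * P - - 1ℤ * (Q * R) ≡ P * P + Q * R
    lemma = solve-∀

  narayana₋₁-suc-≡ : ∀ n k {a b c} →
    gauss₋₁ n (suc k) ≡ + a → gauss₋₁ n (suc (suc k)) ≡ + b → gauss₋₁ n k ≡ + c →
    narayana₋₁ n (suc k) ≡ + (a ℕ.* a ℕ.+ b ℕ.* c)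
  narayana₋₁-suc-≡ n k {a} {b} {c} p q r = begin
    narayana₋₁ n (suc k)              ≡⟨ narayana₋₁-suc n k ⟩
    _                                 ≡⟨ cong₂ _+_ (cong₂ _*_ p p) (cong₂ _*_ q r) ⟩
    + a * + a + + b * + c             ≡⟨ cong₂ _+_ (sym (ℤP.pos-* a a)) (sym (ℤP.pos-* b c)) ⟩
    + (a ℕ.* a ℕ.+ b ℕ.* c)           ∎

  narayana₋₁-even-even : ∀ m i → narayana₋₁ (double m) (double i) ≡ + ((m C i) ℕ.* (m C i))
  narayana₋₁-even-even m zero = refl
  narayana₋₁-even-even m (suc i) = trans
    (narayana₋₁-suc-≡ (double m) (suc (double i))
      (gauss₋₁-even-even m (suc i)) (gauss₋₁-even-odd m (suc i)) (gauss₋₁-even-odd m i))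
    (cong +_ (ℕP.+-identityʳ _))

  narayana₋₁-even-odd : ∀ m i → narayana₋₁ (double m) (suc (double i)) ≡ + ((m C i) ℕ.* (m C suc i))
  narayana₋₁-even-odd m i = trans
    (narayana₋₁-suc-≡ (double m) (double i)
      (gauss₋₁-even-odd m i) (gauss₋₁-even-even m (suc i)) (gauss₋₁-even-even m i))
    (cong +_ (ℕP.*-comm (m C suc i) (m C i)))

  narayana₋₁-odd-even : ∀ m i → narayana₋₁ (suc (double m)) (double i) ≡ + ((m C i) ℕ.* (suc m C i))
  narayana₋₁-odd-even m zero = refl
  narayana₋₁-odd-even m (suc i) = trans
    (narayana₋₁-suc-≡ (suc (double m)) (suc (double i))
      (gauss₋₁-odd-even m (suc i)) (gauss₋₁-odd-odd m (suc i)) (gauss₋₁-odd-odd m i))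
    (cong +_ (trans (lemma (m C suc i) (m C i)) (cong ((m C suc i) ℕ.*_) (sym (pascal m i)))))
    where
    lemma : ∀ a b → a ℕ.* a ℕ.+ a ℕ.* b ≡ a ℕ.* (b ℕ.+ a)
    lemma = ℕSolver.solve-∀

  narayana₋₁-odd-odd : ∀ m i → narayana₋₁ (suc (double m)) (suc (double i)) ≡ + ((m C i) ℕ.* (suc m C suc i))
  narayana₋₁-odd-odd m i = trans
    (narayana₋₁-suc-≡ (suc (double m)) (double i)
      (gauss₋₁-odd-odd m i) (gauss₋₁-odd-even m (suc i)) (gauss₋₁-odd-even m i))
    (cong +_ (trans (lemma (m C i) (m C suc i)) (cong ((m C i) ℕ.*_) (sym (pascal m i)))))
    where
    lemma : ∀ a b → a ℕ.* a ℕ.+ b ℕ.* a ≡ a ℕ.* (a ℕ.+ b)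
    lemma = ℕSolver.solve-∀

  narayana₋₁-closed : ∀ n k → narayana₋₁ n k ≡ + ((⌊ n /2⌋ C ⌊ k /2⌋) ℕ.* (⌊ suc n /2⌋ C ⌊ k ℕ.+ 1 /2⌋))
  narayana₋₁-closed n k rewrite ℕP.+-comm k 1 with parity n | parity k
  ... | even m | even i rewrite ⌊double/2⌋ m | ⌊1+double/2⌋ m | ⌊double/2⌋ i | ⌊1+double/2⌋ i = narayana₋₁-even-even m i
  ... | even m | odd i  rewrite ⌊double/2⌋ m | ⌊1+double/2⌋ m | ⌊double/2⌋ i | ⌊1+double/2⌋ i = narayana₋₁-even-odd m i
  ... | odd m | even i  rewrite ⌊double/2⌋ m | ⌊1+double/2⌋ m | ⌊double/2⌋ i | ⌊1+double/2⌋ i = narayana₋₁-odd-even m i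
  ... | odd m | odd i   rewrite ⌊double/2⌋ m | ⌊1+double/2⌋ m | ⌊double/2⌋ i | ⌊1+double/2⌋ i = narayana₋₁-odd-odd m i

  -- Vanishing for k ≥ n

  n+d<ᵇn≡false : ∀ n d → (n ℕ.+ d ℕ.<ᵇ n) ≡ false
  n+d<ᵇn≡false zero d = refl
  n+d<ᵇn≡false (suc n) d = n+d<ᵇn≡false n d

  qBinom-> : ∀ n d → qBinom n (suc (n ℕ.+ d)) ≡ []
  qBinom-> n d rewrite n+d<ᵇn≡false n d = refl

  length-⊗-[] : ∀ p → length (p ⊗ []) ≡ length p
  length-⊗-[] [] = refl
  length-⊗-[] (a ∷ p) = cong suc (length-⊗-[] p)

  length-qBinom-diagonal : ∀ n → length (qBinom n n) ≡ 1
  length-qBinom-diagonal n = begin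
    length (qBinom n n)             ≡⟨ cong (λ t → length (qBinom t n)) (ℕP.+-identityʳ n) ⟨
    length (qBinom (n ℕ.+ 0) n)     ≡⟨ cong length (qBinom≡gauss n 0) ⟩
    length (gauss (n ℕ.+ 0) n)      ≡⟨ length-gauss n 0 ⟩
    suc (n ℕ.* 0)                   ≡⟨ cong suc (ℕP.*-zeroʳ n) ⟩
    1                               ∎

  -- At d = 0 only the right-hand q-binomial is empty, and `p ⊗ []` is a list of `length p` zeros
  -- rather than `[]`. Because [n+1;n+1] has length 1, the divisor [n+2] is too long and the
  -- division starts without fuel. For larger d both factors are empty.
  qNarayana-vanishes : ∀ n d → qNarayana (suc n) (suc (n ℕ.+ d)) ≡ []
  qNarayana-vanishes n zero
    rewrite qBinom-> n 0 | ℕP.+-identityʳ n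
          | length-⊗-[] (qBinom (suc n) (suc n)) | length-qBinom-diagonal (suc n)
          | ℕP.0∸n≡0 (length (replicate n 1ℤ)) = refl
  qNarayana-vanishes n (suc d)
    rewrite qBinom-> n (suc d) | ℕP.+-suc n d | qBinom-> (suc n) d = refl

  narayana₋₁-vanishes : ∀ n d → narayana₋₁ n (suc (n ℕ.+ d)) ≡ 0ℤ
  narayana₋₁-vanishes n d
    rewrite narayana₋₁-suc n (n ℕ.+ d) | sym (ℕP.+-suc n d) | gauss-vanishes n (suc d)
          | ℕP.+-suc n d | gauss-vanishes n d = refl

  v≡narayana₋₁ : ∀ n k → v (suc n) k ≡ narayana₋₁ n k
  v≡narayana₋₁ n k with ℕP.≤-<-connex k n
  ... | inj₁ k≤n with l , refl ← ℕP.m≤n⇒∃[o]m+o≡n k≤n = cong (λ p → eval p -1ℤ) (qNarayana≡narayana k l)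
  ... | inj₂ n<k with d , refl ← ℕP.m≤n⇒∃[o]m+o≡n n<k =
    trans (cong (λ p → eval p -1ℤ) (qNarayana-vanishes n d)) (sym (narayana₋₁-vanishes n d))

  v-closed : ∀ n k → v (suc n) k ≡ + ((⌊ n /2⌋ C ⌊ k /2⌋) ℕ.* (⌊ suc n /2⌋ C ⌊ k ℕ.+ 1 /2⌋))
  v-closed n k = trans (v≡narayana₋₁ n k) (narayana₋₁-closed n k)

module SymmetricPaths where
  import Data.Bool.Properties as 𝔹P
  open import Data.Bool.ListAction using (and)
  open import Data.Nat using (_+_; _*_; _≡ᵇ_)
  open import Data.Nat.ListAction using (sum)
  open import Data.Maybe using (Maybe; just; nothing)
  open import Function using (_∘_)
  open import Relation.Nullary.Decidable using (⌊_⌋; isYes≗does)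
  open ℕSolver using (solve-∀)

  -- Sums over words

  Weight : Set
  Weight = List Step → ℕ

  sumWords : ℕ → Weight → ℕ
  sumWords zero f = f []
  sumWords (suc n) f = sumWords n λ w → f (U ∷ w) + f (D ∷ w)

  sumWords-cong : ∀ n {f g} → (∀ w → length w ≡ n → f w ≡ g w) → sumWords n f ≡ sumWords n g
  sumWords-cong zero h = h [] refl
  sumWords-cong (suc n) h = sumWords-cong n λ w len →
    cong₂ _+_ (h (U ∷ w) (cong suc len)) (h (D ∷ w) (cong suc len))

  sumWords-++ : ∀ m n f → sumWords (m + n) f ≡ sumWords n λ q → sumWords m λ p → f (p ++ q)
  sumWords-++ zero n f = refl
  sumWords-++ (suc m) n f = sumWords-++ m n λ w → f (U ∷ w) + f (D ∷ w)

  -- This removes the sum over first halves, since the second half leaves only one candidate.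
  sumWords-point : ∀ r f → (∀ p → length p ≡ length r → p ≢ r → f p ≡ 0) → sumWords (length r) f ≡ f r
  sumWords-point [] f h = refl
  sumWords-point (U ∷ r) f h = trans
    (sumWords-point r _ λ p len p≢r →
      cong₂ _+_ (h (U ∷ p) (cong suc len) λ { refl → p≢r refl }) (h (D ∷ p) (cong suc len) λ ()))
    (trans (cong (_+_ (f (U ∷ r))) (h (D ∷ r) refl λ ())) (ℕP.+-identityʳ _))
  sumWords-point (D ∷ r) f h = trans
    (sumWords-point r _ λ p len p≢r →
      cong₂ _+_ (h (U ∷ p) (cong suc len) λ ()) (h (D ∷ p) (cong suc len) λ { refl → p≢r refl }))
    (cong (_+ f (D ∷ r)) (h (U ∷ r) refl λ ()))

  𝟙 : Bool → ℕ
  𝟙 true = 1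
  𝟙 false = 0

  length-filterᵇ : ∀ {A : Set} (P : A → Bool) xs → length (filterᵇ P xs) ≡ sum (map (𝟙 ∘ P) xs)
  length-filterᵇ P [] = refl
  length-filterᵇ P (x ∷ xs) with P x
  ... | true = cong suc (length-filterᵇ P xs)
  ... | false = length-filterᵇ P xs

  sum-map-words : ∀ n f → sum (map f (words n)) ≡ sumWords n f
  sum-map-words zero f = ℕP.+-identityʳ _
  sum-map-words (suc n) f = trans (both (words n)) (sum-map-words n _)
    where
    both : ∀ ws → sum (map f (concatMap (λ w → (U ∷ w) ∷ (D ∷ w) ∷ []) ws))
                ≡ sum (map (λ w → f (U ∷ w) + f (D ∷ w)) ws)
    both [] = refl
    both (w ∷ ws) = trans (cong (λ t → f (U ∷ w) + (f (D ∷ w) + t)) (both ws))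
                          (sym (ℕP.+-assoc (f (U ∷ w)) (f (D ∷ w)) _))

  -- Mirror images and heights

  opposite : Step → Step
  opposite U = D
  opposite D = U

  -- Reflection in a vertical line: a path read backwards has its up and down steps exchanged.
  mirror : List Step → List Step
  mirror [] = []
  mirror (s ∷ w) = mirror w ++ opposite s ∷ []

  mirror-++ : ∀ p q → mirror (p ++ q) ≡ mirror q ++ mirror p
  mirror-++ [] q = sym (++-identityʳ _)
  mirror-++ (s ∷ p) q = trans (cong (_++ opposite s ∷ []) (mirror-++ p q)) (++-assoc (mirror q) (mirror p) _)

  mirror-involutive : ∀ w → mirror (mirror w) ≡ w
  mirror-involutive [] = refl
  mirror-involutive (s ∷ w) = trans (mirror-++ (mirror w) (opposite s ∷ []))
    (cong₂ _∷_ (opposite-involutive s) (mirror-involutive w))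
    where
    opposite-involutive : ∀ s → opposite (opposite s) ≡ s
    opposite-involutive U = refl
    opposite-involutive D = refl

  length-mirror : ∀ w → length (mirror w) ≡ length w
  length-mirror [] = refl
  length-mirror (s ∷ w) = trans (length-++ (mirror w)) (trans (ℕP.+-comm _ 1) (cong suc (length-mirror w)))

  -- The starting height of w when its final height is 0.
  height : List Step → ℤ
  height [] = 0ℤ
  height (s ∷ w) = height w ℤ.- stepVal s

  -- Heights measured from the end of the word do not change when a step is prepended, unlike those
  -- in `heights`. For a closed path the two lists agree.
  suffixHeights : List Step → List ℤ
  suffixHeights [] = 0ℤ ∷ []
  suffixHeights (s ∷ w) = height (s ∷ w) ∷ suffixHeights w

  height-++ : ∀ p q → height (p ++ q) ≡ height p ℤ.+ height q
  height-++ [] q = sym (ℤP.+-identityˡ _)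
  height-++ (s ∷ p) q = trans (cong (ℤ._- stepVal s) (height-++ p q)) (lemma (height p) (height q) (stepVal s))
    where
    lemma : ∀ a b c → (a ℤ.+ b) ℤ.- c ≡ (a ℤ.- c) ℤ.+ b
    lemma = ℤSolver.solve-∀

  stepVal-opposite : ∀ s → stepVal (opposite s) ≡ ℤ.- stepVal s
  stepVal-opposite U = refl
  stepVal-opposite D = refl

  height-mirror : ∀ w → height (mirror w) ≡ ℤ.- height w
  height-mirror [] = refl
  height-mirror (s ∷ w) = begin
    height (mirror w ++ opposite s ∷ [])                     ≡⟨ height-++ (mirror w) (opposite s ∷ []) ⟩
    height (mirror w) ℤ.+ (0ℤ ℤ.- stepVal (opposite s))      ≡⟨ cong₂ (λ a b → a ℤ.+ (0ℤ ℤ.- b)) (height-mirror w) (stepVal-opposite s) ⟩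
    ℤ.- height w ℤ.+ (0ℤ ℤ.- (ℤ.- stepVal s))                ≡⟨ lemma (height w) (stepVal s) ⟩
    ℤ.- (height w ℤ.- stepVal s)                             ∎
    where
    lemma : ∀ a b → ℤ.- a ℤ.+ (0ℤ ℤ.- (ℤ.- b)) ≡ ℤ.- (a ℤ.- b)
    lemma = ℤSolver.solve-∀

  suffixHeights-from : ∀ w → suffixHeights w ≡ height w ∷ heightsFrom (height w) w
  suffixHeights-from [] = refl
  suffixHeights-from (s ∷ w) = cong (height (s ∷ w) ∷_)
    (trans (suffixHeights-from w) (cong (λ h → h ∷ heightsFrom h w) (sym (lemma (height w) (stepVal s)))))
    where
    lemma : ∀ a b → (a ℤ.- b) ℤ.+ b ≡ a
    lemma = ℤSolver.solve-∀

  heightsFrom-++ : ∀ h p q → heightsFrom h (p ++ q) ≡ heightsFrom h p ++ heightsFrom (h ℤ.- height p) q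
  heightsFrom-++ h [] q = cong (λ t → heightsFrom t q) (sym (ℤP.+-identityʳ h))
  heightsFrom-++ h (s ∷ p) q = cong ((h ℤ.+ stepVal s) ∷_)
    (trans (heightsFrom-++ (h ℤ.+ stepVal s) p q)
      (cong (λ t → heightsFrom (h ℤ.+ stepVal s) p ++ heightsFrom t q) (lemma h (stepVal s) (height p))))
    where
    lemma : ∀ h s p → (h ℤ.+ s) ℤ.- p ≡ h ℤ.- (p ℤ.- s)
    lemma = ℤSolver.solve-∀

  end-mirror : ∀ w → 0ℤ ℤ.- height (mirror w) ≡ height w
  end-mirror w = trans (cong (λ t → 0ℤ ℤ.- t) (height-mirror w)) (lemma (height w))
    where
    lemma : ∀ a → 0ℤ ℤ.- (ℤ.- a) ≡ a
    lemma = ℤSolver.solve-∀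

  heights-mirror-++ : ∀ w r → heights (mirror w ++ r) ≡ heights (mirror w) ++ heightsFrom (height w) r
  heights-mirror-++ w r = cong (0ℤ ∷_) (trans (heightsFrom-++ 0ℤ (mirror w) r)
    (cong (λ t → heightsFrom 0ℤ (mirror w) ++ heightsFrom t r) (end-mirror w)))

  heights-mirror : ∀ w → heights (mirror w) ≡ reverse (suffixHeights w)
  heights-mirror [] = refl
  heights-mirror (s ∷ w) = begin
    heights (mirror w ++ opposite s ∷ [])
      ≡⟨ heights-mirror-++ w (opposite s ∷ []) ⟩
    heights (mirror w) ++ (height w ℤ.+ stepVal (opposite s)) ∷ []
      ≡⟨ cong₂ (λ L t → L ++ (height w ℤ.+ t) ∷ []) (heights-mirror w) (stepVal-opposite s) ⟩
    reverse (suffixHeights w) ++ height (s ∷ w) ∷ []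
      ≡⟨ unfold-reverse (height (s ∷ w)) (suffixHeights w) ⟨
    reverse (suffixHeights (s ∷ w)) ∎

  stepVal-injective : ∀ s s′ → stepVal s ≡ stepVal s′ → s ≡ s′
  stepVal-injective U U eq = refl
  stepVal-injective D D eq = refl

  heightsFrom-injective : ∀ h w w′ → heightsFrom h w ≡ heightsFrom h w′ → w ≡ w′
  heightsFrom-injective h [] [] eq = refl
  heightsFrom-injective h (s ∷ w) (s′ ∷ w′) eq
    with refl ← stepVal-injective s s′ (∙-cancelˡ h _ _ (∷-injectiveˡ eq))
    = cong (s ∷_) (heightsFrom-injective (h ℤ.+ stepVal s) w w′ (∷-injectiveʳ eq))

  last0-heightsFrom : ∀ h w → last0 (h ∷ heightsFrom h w) ≡ ⌊ (h ℤ.- height w) ℤ.≟ 0ℤ ⌋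
  last0-heightsFrom h [] = cong (λ t → ⌊ t ℤ.≟ 0ℤ ⌋) (sym (ℤP.+-identityʳ h))
  last0-heightsFrom h (s ∷ w) = trans (last0-heightsFrom (h ℤ.+ stepVal s) w)
    (cong (λ t → ⌊ t ℤ.≟ 0ℤ ⌋) (lemma h (stepVal s) (height w)))
    where
    lemma : ∀ h s p → (h ℤ.+ s) ℤ.- p ≡ h ℤ.- (p ℤ.- s)
    lemma = ℤSolver.solve-∀

  -- Symmetry as invariance under reflection

  ≟⇒≡ : ∀ i j → ⌊ i ℤ.≟ j ⌋ ≡ true → i ≡ j
  ≟⇒≡ i j eq with i ℤ.≟ j
  ... | yes i≡j = i≡j

  ≡⇒≟ : ∀ i j → i ≡ j → ⌊ i ℤ.≟ j ⌋ ≡ true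
  ≡⇒≟ i j i≡j with i ℤ.≟ j
  ... | yes _ = refl
  ... | no i≢j = ⊥-elim (i≢j i≡j)

  ∧-trueˡ : ∀ {a b} → a ∧ b ≡ true → a ≡ true
  ∧-trueˡ {true} eq = refl

  ∧-trueʳ : ∀ {a b} → a ∧ b ≡ true → b ≡ true
  ∧-trueʳ {true} eq = eq

  listEqᵇ⇒≡ : ∀ xs ys → listEqᵇ xs ys ≡ true → xs ≡ ys
  listEqᵇ⇒≡ [] [] eq = refl
  listEqᵇ⇒≡ (x ∷ xs) (y ∷ ys) eq = cong₂ _∷_ (≟⇒≡ x y (∧-trueˡ eq)) (listEqᵇ⇒≡ xs ys (∧-trueʳ eq))

  listEqᵇ-refl : ∀ xs → listEqᵇ xs xs ≡ true
  listEqᵇ-refl [] = refl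
  listEqᵇ-refl (x ∷ xs) rewrite ≡⇒≟ x x refl = listEqᵇ-refl xs

  heights-closed : ∀ w → height w ≡ 0ℤ → heights w ≡ suffixHeights w
  heights-closed w eq = trans (cong (λ h → h ∷ heightsFrom h w) (sym eq)) (sym (suffixHeights-from w))

  last0⇒height≡0 : ∀ w → last0 (heights w) ≡ true → height w ≡ 0ℤ
  last0⇒height≡0 w eq = trans (lemma (height w))
    (cong ℤ.-_ (≟⇒≡ _ _ (trans (sym (last0-heightsFrom 0ℤ w)) eq)))
    where
    lemma : ∀ a → a ≡ ℤ.- (0ℤ ℤ.- a)
    lemma = ℤSolver.solve-∀

  height≡0⇒last0 : ∀ w → height w ≡ 0ℤ → last0 (heights w) ≡ true
  height≡0⇒last0 w eq = trans (last0-heightsFrom 0ℤ w) (≡⇒≟ _ _ (cong (λ t → 0ℤ ℤ.- t) eq))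

  -- For a path ending at height 0 the reversed heights are those of its mirror image, and heights
  -- determine a word.
  symmetric⇒mirror : ∀ w → last0 (heights w) ≡ true → isSymmetric w ≡ true → w ≡ mirror w
  symmetric⇒mirror w closed sym-w = heightsFrom-injective 0ℤ w (mirror w) (∷-injectiveʳ (begin
    heights w                     ≡⟨ listEqᵇ⇒≡ _ _ sym-w ⟩
    reverse (heights w)           ≡⟨ cong reverse (heights-closed w (last0⇒height≡0 w closed)) ⟩
    reverse (suffixHeights w)     ≡⟨ heights-mirror w ⟨
    heights (mirror w)            ∎))

  mirror⇒symmetric : ∀ w → height w ≡ 0ℤ → w ≡ mirror w → isSymmetric w ≡ true
  mirror⇒symmetric w closed eq = trans (cong (listEqᵇ (heights w)) (sym (begin
    heights w                     ≡⟨ cong heights eq ⟩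
    heights (mirror w)            ≡⟨ heights-mirror w ⟩
    reverse (suffixHeights w)     ≡⟨ cong reverse (heights-closed w closed) ⟨
    reverse (heights w)           ∎))) (listEqᵇ-refl (heights w))

  nonnegative : List ℤ → Bool
  nonnegative L = and (map (λ h → 0ℤ ℤ.≤ᵇ h) L)

  nonnegative-++ : ∀ K L → nonnegative (K ++ L) ≡ nonnegative K ∧ nonnegative L
  nonnegative-++ [] L = refl
  nonnegative-++ (x ∷ K) L = trans (cong ((0ℤ ℤ.≤ᵇ x) ∧_) (nonnegative-++ K L))
                                   (sym (𝔹P.∧-assoc (0ℤ ℤ.≤ᵇ x) _ _))

  nonnegative-reverse : ∀ L → nonnegative (reverse L) ≡ nonnegative L
  nonnegative-reverse [] = refl
  nonnegative-reverse (x ∷ L) = begin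
    nonnegative (reverse (x ∷ L))                       ≡⟨ cong nonnegative (unfold-reverse x L) ⟩
    nonnegative (reverse L ++ x ∷ [])                   ≡⟨ nonnegative-++ (reverse L) (x ∷ []) ⟩
    nonnegative (reverse L) ∧ ((0ℤ ℤ.≤ᵇ x) ∧ true)      ≡⟨ cong₂ _∧_ (nonnegative-reverse L) (𝔹P.∧-identityʳ _) ⟩
    nonnegative L ∧ (0ℤ ℤ.≤ᵇ x)                         ≡⟨ 𝔹P.∧-comm (nonnegative L) _ ⟩
    (0ℤ ℤ.≤ᵇ x) ∧ nonnegative L                         ∎

  ∧-absorb-tail : ∀ b t → (b ∧ t) ∧ t ≡ b ∧ t
  ∧-absorb-tail b t = trans (𝔹P.∧-assoc b t t) (cong (b ∧_) (𝔹P.∧-idem t))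

  -- Both halves visit the same heights, so the second conjunct is absorbed; the central height is
  -- listed with the first half.
  nonnegative-mirror-++ : ∀ q → nonnegative (heights (mirror q ++ q)) ≡ nonnegative (suffixHeights q)
  nonnegative-mirror-++ q = begin
    nonnegative (heights (mirror q ++ q))
      ≡⟨ cong nonnegative (trans (heights-mirror-++ q q) (cong (_++ rest) (heights-mirror q))) ⟩
    nonnegative (reverse (suffixHeights q) ++ rest)
      ≡⟨ nonnegative-++ (reverse (suffixHeights q)) rest ⟩
    nonnegative (reverse (suffixHeights q)) ∧ nonnegative rest
      ≡⟨ cong (_∧ nonnegative rest) (trans (nonnegative-reverse (suffixHeights q)) (cong nonnegative (suffixHeights-from q))) ⟩
    ((0ℤ ℤ.≤ᵇ height q) ∧ nonnegative rest) ∧ nonnegative rest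
      ≡⟨ ∧-absorb-tail (0ℤ ℤ.≤ᵇ height q) (nonnegative rest) ⟩
    (0ℤ ℤ.≤ᵇ height q) ∧ nonnegative rest
      ≡⟨ cong nonnegative (suffixHeights-from q) ⟨
    nonnegative (suffixHeights q) ∎
    where
    rest : List ℤ
    rest = heightsFrom (height q) q

  ++-injectiveˡ : ∀ {A : Set} (p p′ : List A) {q q′} → length p ≡ length p′ → p ++ q ≡ p′ ++ q′ → p ≡ p′
  ++-injectiveˡ [] [] len eq = refl
  ++-injectiveˡ (x ∷ p) (y ∷ p′) len eq =
    cong₂ _∷_ (∷-injectiveˡ eq) (++-injectiveˡ p p′ (ℕP.suc-injective len) (∷-injectiveʳ eq))

  -- Reduction to second halves

  symmetricDyck : ℕ → List Step → Bool
  symmetricDyck k w = isDyck w ∧ isSymmetric w ∧ ⌊ valleys w ℕ.≟ k ⌋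

  symmetricDyck⇒mirror : ∀ k p q → length p ≡ length q → symmetricDyck k (p ++ q) ≡ true → p ≡ mirror q
  symmetricDyck⇒mirror k p q len eq = ++-injectiveˡ p (mirror q)
    (trans len (sym (length-mirror q)))
    (trans (symmetric⇒mirror (p ++ q) (∧-trueʳ (∧-trueˡ {isDyck (p ++ q)} eq))
             (∧-trueˡ (∧-trueʳ {isDyck (p ++ q)} eq)))
      (mirror-++ p q))

  -- The centre of mirror q ++ q is a valley exactly when q starts with U.
  mirrorValleys : Step → ℕ → ℕ
  mirrorValleys U j = suc (double j)
  mirrorValleys D j = double j

  -- `mirror q` ends in `D` exactly when `q` starts with `U`, so this detects a valley at the seam
  -- of `mirror q ++ r`.
  joint : List Step → List Step → ℕ
  joint (U ∷ _) (U ∷ _) = 1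
  joint _ _ = 0

  -- With `r` arbitrary, the induction carries the first step of the left word across the seam,
  -- turned into its opposite; only pairs next to the seam have to be recounted.
  valleys-mirror-++ : ∀ q r → valleys (mirror q ++ r) ≡ valleys q + joint q r + valleys r
  valleys-mirror-++ [] r = refl
  valleys-mirror-++ (s ∷ q) r = trans (cong valleys (++-assoc (mirror q) (opposite s ∷ []) r))
    (trans (valleys-mirror-++ q (opposite s ∷ r)) (move s q r))
    where
    move : ∀ s q r → valleys q + joint q (opposite s ∷ r) + valleys (opposite s ∷ r)
                     ≡ valleys (s ∷ q) + joint (s ∷ q) r + valleys r
    move U [] [] = refl
    move U [] (U ∷ r) = refl
    move U [] (D ∷ r) = refl
    move U (U ∷ q) [] = refl
    move U (U ∷ q) (U ∷ r) = lemma (valleys (U ∷ q)) (valleys (U ∷ r))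
      where
      lemma : ∀ a b → a + 0 + suc b ≡ a + 1 + b
      lemma = solve-∀
    move U (U ∷ q) (D ∷ r) = refl
    move U (D ∷ q) [] = refl
    move U (D ∷ q) (U ∷ r) = lemma (valleys (D ∷ q)) (valleys (U ∷ r))
      where
      lemma : ∀ a b → a + 0 + suc b ≡ a + 1 + b
      lemma = solve-∀
    move U (D ∷ q) (D ∷ r) = refl
    move D [] r = refl
    move D (U ∷ q) r = lemma (valleys (U ∷ q)) (valleys r)
      where
      lemma : ∀ a b → a + 1 + b ≡ suc a + 0 + b
      lemma = solve-∀
    move D (D ∷ q) r = refl

  double≡+ : ∀ j → double j ≡ j + j
  double≡+ zero = refl
  double≡+ (suc j) = cong suc (trans (cong suc (double≡+ j)) (sym (ℕP.+-suc j j)))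

  valleys-mirror-self : ∀ s q → valleys (mirror (s ∷ q) ++ s ∷ q) ≡ mirrorValleys s (valleys (s ∷ q))
  valleys-mirror-self U q = trans (valleys-mirror-++ (U ∷ q) (U ∷ q))
    (trans (lemma (valleys (U ∷ q))) (cong suc (sym (double≡+ (valleys (U ∷ q))))))
    where
    lemma : ∀ a → a + 1 + a ≡ suc (a + a)
    lemma = solve-∀
  valleys-mirror-self D q = trans (valleys-mirror-++ (D ∷ q) (D ∷ q))
    (trans (cong (_+ valleys (D ∷ q)) (ℕP.+-identityʳ (valleys (D ∷ q)))) (sym (double≡+ (valleys (D ∷ q)))))

  height-mirror-self : ∀ q → height (mirror q ++ q) ≡ 0ℤ
  height-mirror-self q = trans (height-++ (mirror q) q)
    (trans (cong (ℤ._+ height q) (height-mirror q)) (ℤP.+-inverseˡ (height q)))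

  mirror-mirror-self : ∀ q → mirror q ++ q ≡ mirror (mirror q ++ q)
  mirror-mirror-self q = sym (trans (mirror-++ (mirror q) q) (cong (mirror q ++_) (mirror-involutive q)))

  symmetricDyck-mirror : ∀ k s q → symmetricDyck k (mirror (s ∷ q) ++ s ∷ q)
    ≡ nonnegative (suffixHeights (s ∷ q)) ∧ (mirrorValleys s (valleys (s ∷ q)) ≡ᵇ k)
  symmetricDyck-mirror k s q = trans
    (cong₂ _∧_
      (cong₂ _∧_ (nonnegative-mirror-++ (s ∷ q)) (height≡0⇒last0 w closed))
      (cong₂ _∧_ (mirror⇒symmetric w closed (mirror-mirror-self (s ∷ q)))
        (trans (isYes≗does (valleys w ℕ.≟ k)) (cong (_≡ᵇ k) (valleys-mirror-self s q)))))
    (cong (_∧ (mirrorValleys s (valleys (s ∷ q)) ≡ᵇ k)) (𝔹P.∧-identityʳ _))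
    where
    w : List Step
    w = mirror (s ∷ q) ++ s ∷ q
    closed : height w ≡ 0ℤ
    closed = height-mirror-self (s ∷ q)

  -- Arguments: first step, starting height and number of valleys of a word.
  Statistic : Set
  Statistic = Step → ℕ → ℕ → ℕ

  -- Second halves and the transfer operator

  -- The starting height of a word ending on the axis, with `nothing` for a word that goes below it:
  -- `height` and `nonnegative` in one natural-valued function.
  level : List Step → Maybe ℕ
  level [] = just 0
  level (D ∷ w) with level w
  ... | just h = just (suc h)
  ... | nothing = nothing
  level (U ∷ w) with level w
  ... | just (suc h) = just h
  ... | _ = nothing

  weigh : Statistic → Weight
  weigh F [] = 0
  weigh F (s ∷ w) with level (s ∷ w)
  ... | just h = F s h (valleys (s ∷ w))
  ... | nothing = 0

  LevelSpec : List Step → Maybe ℕ → Set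
  LevelSpec w (just h) = height w ≡ + h × nonnegative (suffixHeights w) ≡ true
  LevelSpec w nothing = nonnegative (suffixHeights w) ≡ false

  level-correct : ∀ w → LevelSpec w (level w)
  level-correct [] = refl , refl
  level-correct (D ∷ w) with level w | level-correct w
  ... | just h | eq , nn rewrite eq | nn | ℕP.+-comm h 1 = refl , refl
  ... | nothing | nn rewrite nn = 𝔹P.∧-zeroʳ _
  level-correct (U ∷ w) with level w | level-correct w
  ... | just (suc h) | eq , nn rewrite eq | nn = refl , refl
  ... | just zero | eq , nn rewrite eq = refl
  ... | nothing | nn rewrite nn = 𝔹P.∧-zeroʳ _

  valleyCount : ℕ → Statistic
  valleyCount k s h j = 𝟙 (mirrorValleys s j ≡ᵇ k)

  weigh-valleyCount : ∀ k s q → 𝟙 (symmetricDyck k (mirror (s ∷ q) ++ s ∷ q)) ≡ weigh (valleyCount k) (s ∷ q)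
  weigh-valleyCount k s q rewrite symmetricDyck-mirror k s q with level (s ∷ q) | level-correct (s ∷ q)
  ... | just h | _ , nn rewrite nn = refl
  ... | nothing | nn rewrite nn = refl

  u≡sumWords : ∀ n k → u (suc n) k ≡ sumWords (suc n) (weigh (valleyCount k))
  u≡sumWords n k = begin
    u m k
      ≡⟨ length-filterᵇ (symmetricDyck k) (words (2 * m)) ⟩
    sum (map (𝟙 ∘ symmetricDyck k) (words (2 * m)))
      ≡⟨ sum-map-words (2 * m) (𝟙 ∘ symmetricDyck k) ⟩
    sumWords (2 * m) (𝟙 ∘ symmetricDyck k)
      ≡⟨ cong (λ t → sumWords (m + t) (𝟙 ∘ symmetricDyck k)) (ℕP.+-identityʳ m) ⟩
    sumWords (m + m) (𝟙 ∘ symmetricDyck k)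
      ≡⟨ sumWords-++ m m (𝟙 ∘ symmetricDyck k) ⟩
    sumWords m (λ q → sumWords m λ p → 𝟙 (symmetricDyck k (p ++ q)))
      ≡⟨ sumWords-cong m half ⟩
    sumWords m (weigh (valleyCount k)) ∎
    where
    m : ℕ
    m = suc n
    𝟙-false : ∀ {b} → b ≢ true → 𝟙 b ≡ 0
    𝟙-false {true} b≢true = ⊥-elim (b≢true refl)
    𝟙-false {false} b≢true = refl
    half : ∀ q → length q ≡ m → sumWords m (λ p → 𝟙 (symmetricDyck k (p ++ q))) ≡ weigh (valleyCount k) q
    half q@(s ∷ q′) len = begin
      sumWords m f                          ≡⟨ cong (λ t → sumWords t f) (sym (trans (length-mirror q) len)) ⟩
      sumWords (length (mirror q)) f        ≡⟨ sumWords-point (mirror q) f others ⟩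
      f (mirror q)                          ≡⟨ weigh-valleyCount k s q′ ⟩
      weigh (valleyCount k) q               ∎
      where
      f : Weight
      f p = 𝟙 (symmetricDyck k (p ++ q))
      others : ∀ p → length p ≡ length (mirror q) → p ≢ mirror q → f p ≡ 0
      others p len-p p≢ = 𝟙-false λ eq →
        p≢ (symmetricDyck⇒mirror k p q (trans len-p (length-mirror q)) eq)

  -- The transfer operator: its value at a word is the sum of `F` over the two one-step extensions
  -- to the left. A `D` put before a `U` creates a valley, and a `U` cannot be put before a word
  -- that starts on the axis.
  prepend : Statistic → Statistic
  prependD prependU : Statistic → Statistic
  prependD F U h j = F D (suc h) (suc j)
  prependD F D h j = F D (suc h) j
  prependU F s zero j = 0
  prependU F s (suc h) j = F U h j
  prepend F s h j = prependU F s h j + prependD F s h j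

  -- The index is one less than the number of steps. The base case is the single step `D`, which
  -- starts at height 1; the single step `U` would start below the axis.
  total : ℕ → Statistic → ℕ
  total zero F = F D 1 0
  total (suc n) F = total n (prepend F)

  weigh-prepend : ∀ F s w → weigh F (U ∷ s ∷ w) + weigh F (D ∷ s ∷ w) ≡ weigh (prepend F) (s ∷ w)
  weigh-prepend F U w with level (U ∷ w)
  ... | just zero = refl
  ... | just (suc h) = refl
  ... | nothing = refl
  weigh-prepend F D w with level (D ∷ w)
  ... | just zero = refl
  ... | just (suc h) = refl
  ... | nothing = refl

  sumWords-weigh : ∀ n F → sumWords (suc n) (weigh F) ≡ total n F
  sumWords-weigh zero F = refl
  sumWords-weigh (suc n) F = trans
    (sumWords-cong (suc n)
      {λ w → weigh F (U ∷ w) + weigh F (D ∷ w)} {weigh (prepend F)}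
      λ { (s ∷ w) _ → weigh-prepend F s w })
    (sumWords-weigh n (prepend F))

  _⊞_ : Statistic → Statistic → Statistic
  (F ⊞ G) s h j = F s h j + G s h j

  infix 4 _≐_
  _≐_ : Statistic → Statistic → Set
  F ≐ G = ∀ s h j → F s h j ≡ G s h j

  prepend-cong : ∀ {F G} → F ≐ G → prepend F ≐ prepend G
  prepend-cong eq U zero j = eq D 1 (suc j)
  prepend-cong eq U (suc h) j = cong₂ _+_ (eq U h j) (eq D (suc (suc h)) (suc j))
  prepend-cong eq D zero j = eq D 1 j
  prepend-cong eq D (suc h) j = cong₂ _+_ (eq U h j) (eq D (suc (suc h)) j)

  total-cong : ∀ n {F G} → F ≐ G → total n F ≡ total n G
  total-cong zero eq = eq D 1 0
  total-cong (suc n) eq = total-cong n (prepend-cong eq)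

  prepend-⊞ : ∀ F G → prepend (F ⊞ G) ≐ prepend F ⊞ prepend G
  prepend-⊞ F G U zero j = refl
  prepend-⊞ F G U (suc h) j = lemma (F U h j) (G U h j) _ _
    where
    lemma : ∀ a b c d → (a + b) + (c + d) ≡ (a + c) + (b + d)
    lemma = solve-∀
  prepend-⊞ F G D zero j = refl
  prepend-⊞ F G D (suc h) j = lemma (F U h j) (G U h j) _ _
    where
    lemma : ∀ a b c d → (a + b) + (c + d) ≡ (a + c) + (b + d)
    lemma = solve-∀

  total-⊞ : ∀ n F G → total n (F ⊞ G) ≡ total n F + total n G
  total-⊞ zero F G = refl
  total-⊞ (suc n) F G = trans (total-cong n (prepend-⊞ F G)) (total-⊞ n (prepend F) (prepend G))

  total-zero : ∀ n → total n (λ _ _ _ → 0) ≡ 0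
  total-zero zero = refl
  total-zero (suc n) = trans (total-cong n λ { U zero j → refl ; U (suc h) j → refl
                                              ; D zero j → refl ; D (suc h) j → refl }) (total-zero n)

  -- Recursions by first step, starting height and valleys

  δ : ℕ → ℕ → ℕ
  δ m n = 𝟙 (m ≡ᵇ n)

  isStep : Step → Step → ℕ
  isStep U U = 1
  isStep D D = 1
  isStep _ _ = 0

  first : Step → ℕ → Statistic
  first t v s h j = isStep t s * δ j v

  at : Step → ℕ → ℕ → Statistic
  at t a v s h j = isStep t s * (δ h a * δ j v)

  double-δ : ∀ j v → 𝟙 (double j ≡ᵇ double v) ≡ δ j v
  double-δ zero zero = refl
  double-δ zero (suc v) = refl
  double-δ (suc j) zero = refl
  double-δ (suc j) (suc v) = double-δ j v

  -- The parity of the number of valleys tells whether the centre is a valley, and hence fixes the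
  -- first step of the half.
  valleyCount-even : ∀ v → valleyCount (double v) ≐ first D v
  valleyCount-even v U h j = odd≢even j v
    where
    odd≢even : ∀ j v → 𝟙 (suc (double j) ≡ᵇ double v) ≡ 0
    odd≢even j zero = refl
    odd≢even zero (suc v) = refl
    odd≢even (suc j) (suc v) = odd≢even j v
  valleyCount-even v D h j = trans (double-δ j v) (sym (ℕP.+-identityʳ _))

  valleyCount-odd : ∀ v → valleyCount (suc (double v)) ≐ first U v
  valleyCount-odd v U h j = trans (double-δ j v) (sym (ℕP.+-identityʳ _))
  valleyCount-odd v D h j = even≢odd j v
    where
    even≢odd : ∀ j v → 𝟙 (double j ≡ᵇ suc (double v)) ≡ 0
    even≢odd zero v = refl
    even≢odd (suc j) zero = refl
    even≢odd (suc j) (suc v) = even≢odd j v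

  at-D-zero : ∀ n v → total n (at D 0 v) ≡ 0
  at-D-zero zero v = refl
  at-D-zero (suc n) v = trans (total-cong n λ { U zero j → refl ; U (suc h) j → refl
                                              ; D zero j → refl ; D (suc h) j → refl }) (total-zero n)

  at-D-suc-zero : ∀ n a → total (suc n) (at D (suc a) 0) ≡ total n (at D a 0)
  at-D-suc-zero n a = total-cong n λ
    { U zero j → trans (ℕP.+-identityʳ _) (ℕP.*-zeroʳ (δ 0 a))
    ; U (suc h) j → trans (ℕP.+-identityʳ _) (ℕP.*-zeroʳ (δ (suc h) a))
    ; D zero j → refl ; D (suc h) j → refl }

  at-D-suc-suc : ∀ n a v → total (suc n) (at D (suc a) (suc v)) ≡ total n (at D a (suc v)) + total n (at U a v)
  at-D-suc-suc n a v = trans (total-cong n λ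
    { U zero j → refl ; U (suc h) j → refl
    ; D zero j → sym (ℕP.+-identityʳ _) ; D (suc h) j → sym (ℕP.+-identityʳ _) })
    (total-⊞ n (at D a (suc v)) (at U a v))

  at-U-suc : ∀ n a v → total (suc n) (at U a v) ≡ total n (at D (suc a) v) + total n (at U (suc a) v)
  at-U-suc n a v = trans (total-cong n λ
    { U zero j → refl ; U (suc h) j → ℕP.+-identityʳ _
    ; D zero j → refl ; D (suc h) j → refl })
    (total-⊞ n (at D (suc a) v) (at U (suc a) v))

  first-D-zero : ∀ n → total (suc n) (first D 0) ≡ total n (first D 0)
  first-D-zero n = total-cong n λ
    { U zero j → refl ; U (suc h) j → refl ; D zero j → refl ; D (suc h) j → refl }

  first-D-suc : ∀ n v → total (suc n) (first D (suc v)) ≡ total n (first D (suc v)) + total n (first U v)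
  first-D-suc n v = trans (total-cong n λ
    { U zero j → refl ; U (suc h) j → refl
    ; D zero j → sym (ℕP.+-identityʳ _) ; D (suc h) j → sym (ℕP.+-identityʳ _) })
    (total-⊞ n (first D (suc v)) (first U v))

  -- U can be prepended unless the word starts on the axis.
  first-U-suc : ∀ n v → total (suc n) (first U v) + total n (at U 0 v)
                      ≡ total n (first D v) + total n (first U v)
  first-U-suc n v = begin
    total n F + total n (at U 0 v)
      -- The term `at D 0 v` is worth 0, since a word starting with `D` starts above the axis; the
      -- pointwise comparison below needs it because `prepend` vanishes at height 0 for either first
      -- step.
      ≡⟨ cong (λ t → total n F + t) (trans (cong (λ t → total n (at U 0 v) + t) (at-D-zero n v)) (ℕP.+-identityʳ _)) ⟨
    total n F + (total n (at U 0 v) + total n (at D 0 v))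
      ≡⟨ cong (λ t → total n F + t) (total-⊞ n (at U 0 v) (at D 0 v)) ⟨
    total n F + total n (at U 0 v ⊞ at D 0 v)
      ≡⟨ total-⊞ n F (at U 0 v ⊞ at D 0 v) ⟨
    total n (F ⊞ (at U 0 v ⊞ at D 0 v))
      ≡⟨ total-cong n (λ
           { U zero j → trans (ℕP.+-identityʳ _) (ℕP.+-identityʳ _)
           ; U (suc h) j → trans (ℕP.+-identityʳ _) (ℕP.+-identityʳ _)
           ; D zero j → refl
           ; D (suc h) j → ℕP.+-identityʳ _ }) ⟩
    total n (first D v ⊞ first U v)
      ≡⟨ total-⊞ n (first D v) (first U v) ⟩
    total n (first D v) + total n (first U v) ∎
    where
    F : Statistic
    F = prepend (first U v)

  -- A word of n + 1 steps from height a to height 0 requires n + 1 and a to have the same parity.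
  total-parity : ∀ n a v c → n + a ≡ double c → total n (at D a v) ≡ 0 × total n (at U a v) ≡ 0
  total-parity zero a v zero refl = refl , refl
  total-parity zero a v (suc c) refl = refl , refl
  total-parity (suc n) a v c eq = down a v c eq ,
    trans (at-U-suc n a v) (cong₂ _+_ (proj₁ (total-parity n (suc a) v c eq′)) (proj₂ (total-parity n (suc a) v c eq′)))
    where
    eq′ : n + suc a ≡ double c
    eq′ = trans (ℕP.+-suc n a) eq
    down : ∀ a v c → suc n + a ≡ double c → total (suc n) (at D a v) ≡ 0
    down zero v c eq = at-D-zero (suc n) v
    down (suc a) v (suc c) eq with eq″ ← ℕP.suc-injective (trans (sym (ℕP.+-suc n a)) (ℕP.suc-injective eq)) = down′ v
      where
      down′ : ∀ v → total (suc n) (at D (suc a) v) ≡ 0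
      down′ zero = trans (at-D-suc-zero n a) (proj₁ (total-parity n a 0 c eq″))
      down′ (suc v) = trans (at-D-suc-suc n a v)
        (cong₂ _+_ (proj₁ (total-parity n a (suc v) c eq″)) (proj₂ (total-parity n a v c eq″)))

  -- The reflection formula

  infixl 6.5 _C⁻_
  -- The binomial coefficient with lower index k - 1. At k = 0 Pascal's rule demands 0, where
  -- truncated subtraction would give 1.
  _C⁻_ : ℕ → ℕ → ℕ
  n C⁻ zero = 0
  n C⁻ suc k = n C k

  pascal⁻ : ∀ n k → suc n C k ≡ n C⁻ k + n C k
  pascal⁻ n zero = refl
  pascal⁻ n (suc k) = pascal n k


  total-unreachable : ∀ n a v → (n ℕ.< a → total n (at U a v) ≡ 0) × (suc n ℕ.< a → total n (at D a v) ≡ 0)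
  total-unreachable zero a v = (λ _ → refl) , λ { (s≤s (s≤s z≤n)) → refl }
  total-unreachable (suc n) a v =
    (λ lt → trans (at-U-suc n a v)
      (cong₂ _+_ (proj₂ (total-unreachable n (suc a) v) (ℕP.m<n⇒m<1+n lt))
                 (proj₁ (total-unreachable n (suc a) v) (ℕP.m<n⇒m<1+n (ℕP.<-trans (ℕP.n<1+n n) lt))))) ,
    down a v
    where
    down : ∀ a v → suc (suc n) ℕ.< a → total (suc n) (at D a v) ≡ 0
    down (suc a) zero (s≤s lt) = trans (at-D-suc-zero n a) (proj₂ (total-unreachable n a 0) lt)
    down (suc a) (suc v) (s≤s lt) = trans (at-D-suc-suc n a v)
      (cong₂ _+_ (proj₂ (total-unreachable n a (suc v)) lt)
                 (proj₁ (total-unreachable n a v) (ℕP.<-trans (ℕP.n<1+n n) lt)))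

  total-all-down : ∀ n v → total n (at D (suc n) v) ≡ δ 0 v
  total-all-down zero v = trans (ℕP.+-identityʳ _) (ℕP.+-identityʳ _)
  total-all-down (suc n) zero = trans (at-D-suc-zero n (suc n)) (total-all-down n 0)
  total-all-down (suc n) (suc v) = trans (at-D-suc-suc n (suc n) v)
    (cong₂ _+_ (total-all-down n (suc v)) (proj₁ (total-unreachable n (suc n) v) (ℕP.n<1+n n)))

  -- Reflection: the paths that leave the half-plane are subtracted, with the
  -- subtrahend moved to the left-hand side.  The words have b + 1 up steps.
  total-at-U : ∀ b a v → total (suc (double b + a)) (at U a v) + (b C suc v) * ((b + a) C⁻ v)
                       ≡ ((b + a) C v) * (b C v)
  total-at-D : ∀ b a v → total (suc (double b + a)) (at D a v) + (b C v) * ((b + a) C⁻ v)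
                       ≡ ((b + a) C v) * (b C⁻ v)

  -- With the leading `U` as the only up step, the word must continue with a + 1 down steps and has
  -- no valley.
  total-at-U zero a v = trans (ℕP.+-identityʳ _) (trans (at-U-suc a a v) (trans
    (cong₂ _+_ (total-all-down a v) (proj₁ (total-unreachable a (suc a) v) (ℕP.n<1+n a))) (base v)))
    where
    base : ∀ v → δ 0 v + 0 ≡ (a C v) * (0 C v)
    base zero = refl
    base (suc v) = sym (ℕP.*-zeroʳ (a C suc v))
  total-at-U (suc b) a v = begin
    total (suc (suc m)) (at U a v) + (suc b C suc v) * dm
      ≡⟨ cong₂ (λ s t → s + t * dm) (at-U-suc (suc m) a v) (pascal b v) ⟩
    (x + y) + (b C v + b C suc v) * dm
      ≡⟨ lemma₁ x y (b C v) (b C suc v) dm ⟩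
    (x + (b C v) * dm) + (y + (b C suc v) * dm)
      -- Removing the leading `U` leaves a word with one up step fewer that starts one higher, so b
      -- decreases while a grows and b + a + 1 keeps its value.
      ≡⟨ cong₂ _+_
           (subst₂ (λ m d → total m (at D (suc a) v) + (b C v) * (d C⁻ v) ≡ (d C v) * (b C⁻ v))
             (cong suc (ℕP.+-suc (double b) a)) (ℕP.+-suc b a) (total-at-D b (suc a) v))
           (subst₂ (λ m d → total m (at U (suc a) v) + (b C suc v) * (d C⁻ v) ≡ (d C v) * (b C v))
             (cong suc (ℕP.+-suc (double b) a)) (ℕP.+-suc b a) (total-at-U b (suc a) v)) ⟩
    d₀ * (b C⁻ v) + d₀ * (b C v)
      ≡⟨ ℕP.*-distribˡ-+ d₀ (b C⁻ v) (b C v) ⟨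
    d₀ * (b C⁻ v + b C v)
      ≡⟨ cong (d₀ *_) (pascal⁻ b v) ⟨
    d₀ * (suc b C v) ∎
    where
    m x y dm d₀ : ℕ
    m = suc (double b + a)
    x = total (suc m) (at D (suc a) v)
    y = total (suc m) (at U (suc a) v)
    dm = suc (b + a) C⁻ v
    d₀ = suc (b + a) C v
    lemma₁ : ∀ x y b₀ b₁ d → (x + y) + (b₀ + b₁) * d ≡ (x + b₀ * d) + (y + b₁ * d)
    lemma₁ = solve-∀

  -- On the axis the two products coincide, in accordance with the absence of words that start there
  -- with `D`.
  total-at-D b zero v rewrite ℕP.+-identityʳ b | at-D-zero (suc (double b + 0)) v = refl
  total-at-D b (suc a) zero rewrite ℕP.+-suc (double b) a = trans (cong (_+ 0) (at-D-suc-zero (suc (double b + a)) a)) (total-at-D b a zero)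
  total-at-D b (suc a) (suc v) = begin
    total (suc (double b + suc a)) (at D (suc a) (suc v)) + b₁ * ((b + suc a) C v)
      ≡⟨ cong₂ (λ m d → total (suc m) (at D (suc a) (suc v)) + b₁ * (d C v)) (ℕP.+-suc (double b) a) (ℕP.+-suc b a) ⟩
    total (suc m) (at D (suc a) (suc v)) + b₁ * (suc d C v)
      ≡⟨ cong₂ (λ s t → s + b₁ * t) (at-D-suc-suc m a v) (pascal⁻ d v) ⟩
    (x + y) + b₁ * (d C⁻ v + d C v)
      ≡⟨ lemma₁ x y b₁ (d C⁻ v) (d C v) ⟩
    (x + b₁ * (d C v)) + (y + b₁ * (d C⁻ v))
      ≡⟨ cong₂ _+_ (total-at-D b a (suc v)) (total-at-U b a v) ⟩
    (d C suc v) * (b C v) + (d C v) * (b C v)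
      ≡⟨ lemma₂ (d C suc v) (d C v) (b C v) ⟩
    (d C v + d C suc v) * (b C v)
      ≡⟨ cong (_* (b C v)) (pascal d v) ⟨
    (suc d C suc v) * (b C v)
      ≡⟨ cong (λ t → (t C suc v) * (b C v)) (ℕP.+-suc b a) ⟨
    ((b + suc a) C suc v) * (b C v) ∎
    where
    m d x y b₁ : ℕ
    m = suc (double b + a)
    d = b + a
    x = total m (at D a (suc v))
    y = total m (at U a v)
    b₁ = b C suc v
    lemma₁ : ∀ x y b e d → (x + y) + b * (e + d) ≡ (x + b * d) + (y + b * e)
    lemma₁ = solve-∀
    lemma₂ : ∀ d₁ d₀ b → d₁ * b + d₀ * b ≡ (d₀ + d₁) * b
    lemma₂ = solve-∀

  -- Closed forms for the halves

  -- These are the values of `narayana₋₁` at k = 2v for first step `D` and at k = 2v + 1 for first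
  -- step `U`. Apart from the initial cases, Pascal's rule merges the two summands of each
  -- recursion; only `first-U-even` also has to remove halves on the axis.
  first-D-even : ∀ m v → total (double m) (first D v) ≡ (m C v) * (m C v)
  first-U-even : ∀ m v → total (double m) (first U v) ≡ (m C v) * (m C suc v)
  first-D-odd : ∀ m v → total (suc (double m)) (first D v) ≡ (m C v) * (suc m C v)
  first-U-odd : ∀ m v → total (suc (double m)) (first U v) ≡ (m C v) * (suc m C suc v)

  first-D-even zero zero = refl
  first-D-even zero (suc v) = refl
  first-D-even (suc m) zero = trans (first-D-zero (suc (double m))) (first-D-odd m 0)
  first-D-even (suc m) (suc v) = begin
    total (double (suc m)) (first D (suc v))
      ≡⟨ first-D-suc (suc (double m)) v ⟩
    _ ≡⟨ cong₂ _+_ (first-D-odd m (suc v)) (first-U-odd m v) ⟩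
    (m C suc v) * (suc m C suc v) + (m C v) * (suc m C suc v)
      ≡⟨ lemma (m C suc v) (m C v) (suc m C suc v) ⟩
    (m C v + m C suc v) * (suc m C suc v)
      ≡⟨ cong (_* (suc m C suc v)) (pascal m v) ⟨
    (suc m C suc v) * (suc m C suc v) ∎
    where
    lemma : ∀ a b c → a * c + b * c ≡ (b + a) * c
    lemma = solve-∀

  first-U-even zero zero = refl
  first-U-even zero (suc v) = refl
  -- The number `N` of halves on the axis is c² - d e. Adding `c * c` to both sides lets this enter
  -- as `N + d * e` without a subtraction.
  first-U-even (suc m) v = ℕP.+-cancelʳ-≡ (c * c) _ _ (begin
    X + c * c
      ≡⟨ cong (λ t → X + t) axis ⟨
    X + (N + d * e)
      ≡⟨ ℕP.+-assoc X N (d * e) ⟨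
    (X + N) + d * e
      ≡⟨ cong (_+ d * e) (trans (first-U-suc (suc (double m)) v) (cong₂ _+_ (first-D-odd m v) (first-U-odd m v))) ⟩
    (c * (suc m C v) + c * (suc m C suc v)) + d * e
      ≡⟨ cong₂ (λ s t → (c * s + c * t) + d * e) (pascal⁻ m v) (pascal m v) ⟩
    (c * (e + c) + c * (c + d)) + d * e
      ≡⟨ lemma c d e ⟩
    (e + c) * (c + d) + c * c
      ≡⟨ cong₂ (λ s t → s * t + c * c) (pascal⁻ m v) (pascal m v) ⟨
    (suc m C v) * (suc m C suc v) + c * c ∎)
    where
    X N c d e : ℕ
    X = total (double (suc m)) (first U v)
    N = total (suc (double m)) (at U 0 v)
    c = m C v
    d = m C suc v
    e = m C⁻ v
    axis : N + d * e ≡ c * c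
    axis = subst₂ (λ s t → total (suc s) (at U 0 v) + d * (t C⁻ v) ≡ (t C v) * c)
      (ℕP.+-identityʳ (double m)) (ℕP.+-identityʳ m) (total-at-U m 0 v)
    lemma : ∀ c d e → (c * (e + c) + c * (c + d)) + d * e ≡ (e + c) * (c + d) + c * c
    lemma = solve-∀

  first-D-odd m zero = trans (first-D-zero (double m)) (first-D-even m 0)
  first-D-odd m (suc v) = begin
    total (suc (double m)) (first D (suc v))
      ≡⟨ first-D-suc (double m) v ⟩
    _ ≡⟨ cong₂ _+_ (first-D-even m (suc v)) (first-U-even m v) ⟩
    (m C suc v) * (m C suc v) + (m C v) * (m C suc v)
      ≡⟨ lemma (m C suc v) (m C v) ⟩
    (m C suc v) * (m C v + m C suc v)
      ≡⟨ cong ((m C suc v) *_) (pascal m v) ⟨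
    (m C suc v) * (suc m C suc v) ∎
    where
    lemma : ∀ a b → a * a + b * a ≡ a * (b + a)
    lemma = solve-∀

  first-U-odd m v = begin
    total (suc (double m)) (first U v)
      ≡⟨ trans (cong (λ t → total (suc (double m)) (first U v) + t) off-axis) (ℕP.+-identityʳ _) ⟨
    total (suc (double m)) (first U v) + total (double m) (at U 0 v)
      ≡⟨ first-U-suc (double m) v ⟩
    _ ≡⟨ cong₂ _+_ (first-D-even m v) (first-U-even m v) ⟩
    (m C v) * (m C v) + (m C v) * (m C suc v)
      ≡⟨ ℕP.*-distribˡ-+ (m C v) (m C v) (m C suc v) ⟨
    (m C v) * (m C v + m C suc v)
      ≡⟨ cong ((m C v) *_) (pascal m v) ⟨
    (m C v) * (suc m C suc v) ∎
    where
    -- These words have 2m + 1 steps, an odd number, so none of them both starts and ends on the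
    -- axis.
    off-axis : total (double m) (at U 0 v) ≡ 0
    off-axis = proj₂ (total-parity (double m) 0 v m (ℕP.+-identityʳ (double m)))

  u-closed : ∀ n k → u (suc n) k ≡ (⌊ n /2⌋ C ⌊ k /2⌋) * (⌊ suc n /2⌋ C ⌊ k + 1 /2⌋)
  u-closed n k rewrite ℕP.+-comm k 1 | u≡sumWords n k | sumWords-weigh n (valleyCount k) with parity n | parity k
  ... | even m | even i rewrite ⌊double/2⌋ m | ⌊1+double/2⌋ m | ⌊double/2⌋ i | ⌊1+double/2⌋ i =
    trans (total-cong (double m) (valleyCount-even i)) (first-D-even m i)
  ... | even m | odd i rewrite ⌊double/2⌋ m | ⌊1+double/2⌋ m | ⌊double/2⌋ i | ⌊1+double/2⌋ i =
    trans (total-cong (double m) (valleyCount-odd i)) (first-U-even m i)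
  ... | odd m | even i rewrite ⌊double/2⌋ m | ⌊1+double/2⌋ m | ⌊double/2⌋ i | ⌊1+double/2⌋ i =
    trans (total-cong (suc (double m)) (valleyCount-even i)) (first-D-odd m i)
  ... | odd m | odd i rewrite ⌊double/2⌋ m | ⌊1+double/2⌋ m | ⌊double/2⌋ i | ⌊1+double/2⌋ i =
    trans (total-cong (suc (double m)) (valleyCount-odd i)) (first-U-odd m i)

open import Data.Nat using (_≤_; _∸_; _*_; _+_)

theorem1 : (n k : ℕ) → 1 ≤ n →
    (+ u n k ≡ v n k) × (v n k ≡ + ((⌊ n ∸ 1 /2⌋ C ⌊ k /2⌋) * (⌊ n /2⌋ C ⌊ k + 1 /2⌋)))
theorem1 (suc n) k _ =
  trans (cong +_ (SymmetricPaths.u-closed n k)) (sym (QNarayana.v-closed n k)) , QNarayana.v-closed n k
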